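{- For every integer $k\ge 1$ let $S_k:=(0,2,2^2,2^3,\dots,2^{2k},0)$ (a tuple of length $2k+2$). Then for every integer $k\ge 1$ we have $S_k\mapsto S_{k+1}$, and exactly one Overflow rule is applied in passing from $S_k$ to $S_{k+1}$. Consequently the process started at $(0,2,4,0)=S_1$ never halts: $P^j(S_1)$ is defined for every $j\ge 0$.
   Context: A state is a finite tuple of integers $S=(a_\ell,a_{\ell-1},\dots,a_1,a_0)$ with $\ell\ge 0$; $a_i$ is the $i$-th index of $S$ (indices counted from the right, starting at $0$). The successor $P(S)$ is defined by the following rules, which are mutually exclusive. (Overflow) If $a_\ell$ is odd and $a_{\ell-1},\dots,a_0$ are all even, then $P(S)=(0,a_\ell+1,a_{\ell-1},\dots,a_0)$. (Halt) If all entries are even and $a_\ell=a_{\ell-1}=0$, the process halts and $P(S)$ is undefined. (Zero) If all entries are even and $(a_\ell,a_{\ell-1})\neq(0,0)$, then $P(S)=(0,0,a_\ell+1,a_{\ell-1},\dots,a_1,a_0-1)$. (Halve) If $a_0=-1$, then $P(S)=(a_\ell,\dots,a_1)$ (the last entry is deleted). (Increment) In every other case, let $i$ be the smallest index with $a_i$ odd and set $P(S)=(a_\ell,\dots,a_{i+2},a_{i+1}+1,a_i,\dots,a_1,a_0-1)$. Write $S\mapsto T$ if $T=P^j(S)$ for some integer $j\ge 0$ (all intermediate states being defined); the rules applied in passing from $S$ to $T$ are those applied at $S,P(S),\dots,P^{j-1}(S)$. (This process describes the 5-state Turing machine known as Skelet #17.) -}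

module Defs where

open import Data.Nat as ℕ using (ℕ; zero; suc; _^_; _%_)
open import Data.Integer as ℤ using (ℤ; +_; ∣_∣; -[1+_]; 0ℤ)
open import Data.Bool using (Bool; true; false; if_then_else_; _∧_; not)
open import Data.List using (List; []; _∷_; _++_; reverse; map; upTo)
open import Data.Maybe using (Maybe; just; nothing; _>>=_)
open import Data.Product using (_×_; _,_)
open import Relation.Nullary.Decidable using (⌊_⌋)

-- A state (a_ℓ, …, a_0) is a list of integers written in the paper's
-- order (leftmost entry a_ℓ, rightmost entry a_0).
State : Set
State = List ℤ

isOdd : ℤ → Bool
isOdd a = ⌊ ∣ a ∣ % 2 ℕ.≟ 1 ⌋

isEven : ℤ → Bool
isEven a = not (isOdd a)

isZero : ℤ → Bool
isZero a = ⌊ ∣ a ∣ ℕ.≟ 0 ⌋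

isMinusOne : ℤ → Bool
isMinusOne -[1+ zero ] = true
isMinusOne _           = false

allEven : List ℤ → Bool
allEven []       = true
allEven (x ∷ xs) = isEven x ∧ allEven xs

data Rule : Set where
  Overflow Zero Halve Increment : Rule

-- Helpers on the REVERSED list r = (a_0, a_1, …, a_ℓ).

overflowCond : List ℤ → Bool
overflowCond []           = false
overflowCond (x ∷ [])     = isOdd x
overflowCond (x ∷ y ∷ xs) = isEven x ∧ overflowCond (y ∷ xs)

overflowStep : List ℤ → List ℤ
overflowStep []           = []
overflowStep (x ∷ [])     = (x ℤ.+ ℤ.1ℤ) ∷ 0ℤ ∷ []
overflowStep (x ∷ y ∷ xs) = x ∷ overflowStep (y ∷ xs)

topTwoZero : List ℤ → Bool
topTwoZero []           = false
topTwoZero (x ∷ [])     = false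
topTwoZero (x ∷ y ∷ []) = isZero x ∧ isZero y
topTwoZero (x ∷ y ∷ z ∷ xs) = topTwoZero (y ∷ z ∷ xs)

zeroTop : List ℤ → List ℤ
zeroTop []           = []
zeroTop (x ∷ [])     = (x ℤ.+ ℤ.1ℤ) ∷ 0ℤ ∷ 0ℤ ∷ []
zeroTop (x ∷ y ∷ xs) = x ∷ zeroTop (y ∷ xs)

decHead : List ℤ → List ℤ
decHead []       = []
decHead (x ∷ xs) = (x ℤ.- ℤ.1ℤ) ∷ xs

incAfterOdd : List ℤ → List ℤ
incAfterOdd []           = []
incAfterOdd (x ∷ [])     = x ∷ []
incAfterOdd (x ∷ y ∷ xs) =
  if isOdd x then x ∷ (y ℤ.+ ℤ.1ℤ) ∷ xs else x ∷ incAfterOdd (y ∷ xs)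

-- One step on the reversed representation, reporting the rule used.
-- nothing = successor undefined (Halt, or a degenerate state).
stepRev : List ℤ → Maybe (Rule × List ℤ)
stepRev [] = nothing
stepRev r@(a₀ ∷ rest) =
  if overflowCond r then just (Overflow , overflowStep r)
  else if allEven r then
    (if topTwoZero r then nothing
     else (case-len rest))
  else if isMinusOne a₀ then just (Halve , rest)
  else just (Increment , decHead (incAfterOdd r))
  where
    case-len : List ℤ → Maybe (Rule × List ℤ)
    case-len [] = nothing   -- ℓ = 0 with a_0 even: rule not defined
    case-len (_ ∷ _) = just (Zero , decHead (zeroTop r))

stepR : State → Maybe (Rule × State)
stepR S with stepRev (reverse S)
... | nothing       = nothing
... | just (ρ , r)  = just (ρ , reverse r)

P : State → Maybe State
P S with stepR S
... | nothing      = nothing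
... | just (_ , T) = just T

Pⁿ : ℕ → State → Maybe State
Pⁿ zero    S = just S
Pⁿ (suc j) S = P S >>= Pⁿ j

run : ℕ → State → Maybe (List Rule × State)
run zero    S = just ([] , S)
run (suc j) S with stepR S
... | nothing      = nothing
... | just (ρ , T) with run j T
...   | nothing         = nothing
...   | just (ρs , U)   = just (ρ ∷ ρs , U)

isOverflow : Rule → Bool
isOverflow Overflow = true
isOverflow _        = false

countOverflow : List Rule → ℕ
countOverflow []       = 0
countOverflow (ρ ∷ ρs) = (if isOverflow ρ then 1 else 0) ℕ.+ countOverflow ρs

S : ℕ → State
S k = 0ℤ ∷ (map (λ i → + (2 ^ suc i)) (upTo (2 ℕ.* k)) ++ (0ℤ ∷ []))

{-# OPTIONS --safe #-}

-- Read a state from right to left.  While only Increments occur, the parities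
-- of a₁, a₂, … run through the Gray code in one direction, and the entries are
-- 2b + D n or 2b − D n, where n is the Gray counter and D counts 2-adic
-- valuations.  Between two consecutive all-even states the process performs
-- Zero, Increments, Halve, Increments, Halve, Increments, so the passage is an
-- explicit map in terms of D.  In suitable coordinates X₀, …, X_L it adds 1 to a
-- single coordinate p, and the next such p is p − 2 if p ≥ 2, v₂(X₀) if p = 0 and
-- 1 + v₂(X₁) if p = 1, for the incremented X₀ and X₁.  Hence X₁ = 2^(L−1) + t and
-- X₀ both count upwards and hand over to each other exactly at the numbers of
-- odd 2-adic valuation, so that X₀ follows t.  At t = 2^(L−1) the ascending Gray
-- counter overflows; from there p runs through L − 2, L − 4, …, 1, 1 (for the
-- new L), which leads to S_{k+1}.
module Submission where

open import Defs
open import Data.Nat as ℕ using (ℕ; _≥_; zero; suc; _<_; _≤_; z≤n; s≤s; ⌊_/2⌋; ⌈_/2⌉)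
open import Data.List using (List; []; _∷_; _++_; reverse; map; upTo; applyUpTo; applyDownFrom)
open import Data.Maybe using (just)
open import Data.Product using (Σ; _×_; _,_; ∃; proj₁; proj₂)
open import Relation.Binary.PropositionalEquality
open import Data.Bool using (true; false; if_then_else_)
open import Data.Empty using (⊥-elim)
open import Data.Integer as ℤ using (ℤ; +_; -[1+_]; 0ℤ; 1ℤ)
import Data.Integer.Properties as ℤₚ
import Data.Integer.Tactic.RingSolver as ℤR
import Data.List.Properties as Lₚ
import Data.Nat.DivMod as DM
import Data.Nat.Properties as ℕₚ
import Data.Nat.Tactic.RingSolver as ℕR
open import Data.Sum using (_⊎_; inj₁; inj₂)
open import Function using (_∘_)

-- Halving, valuation counts and parities of integers.

data Parity : ℕ → Set where
  even : ∀ k → Parity (k ℕ.+ k)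
  odd  : ∀ k → Parity (suc (k ℕ.+ k))

parity : ∀ n → Parity n
parity zero = even 0
parity (suc n) with parity n
... | even k = odd k
... | odd k  = subst Parity (cong suc (ℕₚ.+-suc k k)) (even (suc k))

half-even : ∀ k → ⌊ k ℕ.+ k /2⌋ ≡ k
half-even k = sym (ℕₚ.n≡⌊n+n/2⌋ k)

half-odd : ∀ k → ⌊ suc (k ℕ.+ k) /2⌋ ≡ k
half-odd k = sym (ℕₚ.n≡⌈n+n/2⌉ k)

pow2 : ℕ → ℕ
pow2 zero    = 1
pow2 (suc n) = pow2 n ℕ.+ pow2 n

-- D n i is the number of m in [1 , n] whose 2-adic valuation is i.
D : ℕ → ℕ → ℕ
D n zero    = ⌈ n /2⌉
D n (suc i) = D ⌊ n /2⌋ i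

double≡*2 : ∀ k → k ℕ.+ k ≡ k ℕ.* 2
double≡*2 = ℕR.solve-∀

rem-even : ∀ k → (k ℕ.+ k) ℕ.% 2 ≡ 0
rem-even k = trans (cong (ℕ._% 2) (double≡*2 k)) (DM.m*n%n≡0 k 2)

rem-odd : ∀ k → suc (k ℕ.+ k) ℕ.% 2 ≡ 1
rem-odd k = trans (cong (λ t → suc t ℕ.% 2) (double≡*2 k)) (DM.[m+kn]%n≡m%n 1 k 2)

isOdd-even : ∀ u → isOdd (u ℤ.+ u) ≡ false
isOdd-even (+ k)     rewrite rem-even k = refl
isOdd-even -[1+ k ]  rewrite trans (cong (λ t → suc t ℕ.% 2) (sym (ℕₚ.+-suc k k))) (rem-even (suc k)) = refl

isOdd-odd : ∀ u → isOdd (u ℤ.+ u ℤ.+ 1ℤ) ≡ true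
isOdd-odd (+ k)    rewrite ℕₚ.+-comm (k ℕ.+ k) 1 | rem-odd k = refl
isOdd-odd -[1+ k ] rewrite rem-odd k = refl

-- Whatever b is, the parities of up b n and of down b n spell the Gray code of n.
up : (ℕ → ℤ) → ℕ → ℕ → ℤ
up b n i = b i ℤ.+ b i ℤ.+ + D n i

down : (ℕ → ℤ) → ℕ → ℕ → ℤ
down b n i = b i ℤ.+ b i ℤ.- + D n i

double-<⁻ : ∀ {a b} → a ℕ.+ a < b ℕ.+ b → a < b
double-<⁻ {a} {b} p = ℕₚ.≰⇒> λ b≤a → ℕₚ.<⇒≱ p (ℕₚ.+-mono-≤ b≤a b≤a)

suc-double-<⁻ : ∀ {a b} → suc (suc (a ℕ.+ a)) < b ℕ.+ b → suc a < b
suc-double-<⁻ {a} {b} p = double-<⁻ (subst (_< b ℕ.+ b) (cong suc (sym (ℕₚ.+-suc a a))) p)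

-- The Increment rule on Gray-coded tails.

up-odd : ∀ x β k → x ≡ β ℤ.+ β ℤ.+ + suc (k ℕ.+ k) → isOdd x ≡ true
up-odd x β k refl = trans (cong isOdd (eq β (+ k))) (isOdd-odd (β ℤ.+ + k))
  where eq : ∀ β κ → β ℤ.+ β ℤ.+ (1ℤ ℤ.+ (κ ℤ.+ κ)) ≡ (β ℤ.+ κ) ℤ.+ (β ℤ.+ κ) ℤ.+ 1ℤ
        eq = ℤR.solve-∀

up-even : ∀ x β k → x ≡ β ℤ.+ β ℤ.+ + suc (suc (k ℕ.+ k)) → isOdd x ≡ false
up-even x β k refl = trans (cong isOdd (eq β (+ k))) (isOdd-even (β ℤ.+ + k ℤ.+ 1ℤ))
  where eq : ∀ β κ → β ℤ.+ β ℤ.+ (1ℤ ℤ.+ (1ℤ ℤ.+ (κ ℤ.+ κ))) ≡ (β ℤ.+ κ ℤ.+ 1ℤ) ℤ.+ (β ℤ.+ κ ℤ.+ 1ℤ)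
        eq = ℤR.solve-∀

down-even : ∀ x β k → x ≡ β ℤ.+ β ℤ.- + suc (suc (k ℕ.+ k)) → isOdd x ≡ false
down-even x β k refl = trans (cong isOdd (eq β (+ k))) (isOdd-even (β ℤ.- + k ℤ.- 1ℤ))
  where eq : ∀ β κ → β ℤ.+ β ℤ.- (1ℤ ℤ.+ (1ℤ ℤ.+ (κ ℤ.+ κ))) ≡ (β ℤ.- κ ℤ.- 1ℤ) ℤ.+ (β ℤ.- κ ℤ.- 1ℤ)
        eq = ℤR.solve-∀

down-odd : ∀ x β k → x ≡ β ℤ.+ β ℤ.- + suc (k ℕ.+ k) → isOdd x ≡ true
down-odd x β k refl = trans (cong isOdd (eq β (+ k))) (isOdd-odd (β ℤ.- + k ℤ.- 1ℤ))
  where eq : ∀ β κ → β ℤ.+ β ℤ.- (1ℤ ℤ.+ (κ ℤ.+ κ)) ≡ (β ℤ.- κ ℤ.- 1ℤ) ℤ.+ (β ℤ.- κ ℤ.- 1ℤ) ℤ.+ 1ℤ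
        eq = ℤR.solve-∀

down-suc : ∀ b k → b ℤ.+ b ℤ.- + suc k ℤ.+ 1ℤ ≡ b ℤ.+ b ℤ.- + k
down-suc b k = eq b (+ k)
  where eq : ∀ b κ → b ℤ.+ b ℤ.- (1ℤ ℤ.+ κ) ℤ.+ 1ℤ ≡ b ℤ.+ b ℤ.- κ
        eq = ℤR.solve-∀

up-suc : ∀ b k → b ℤ.+ b ℤ.+ + k ℤ.+ 1ℤ ≡ b ℤ.+ b ℤ.+ + suc k
up-suc b k = eq b (+ k)
  where eq : ∀ b κ → b ℤ.+ b ℤ.+ κ ℤ.+ 1ℤ ≡ b ℤ.+ b ℤ.+ (1ℤ ℤ.+ κ)
        eq = ℤR.solve-∀

-- For odd `suc n` the head is odd, and the increment lands on the next entry, where `D` gains 1.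
-- Otherwise the head is even and the next entry has the parity of `suc ⌊ n /2⌋`, so the argument
-- recurses on the halved counter. The bound keeps the lowest odd entry away from the top.
inc-up : ∀ len n x β b → suc n < pow2 len → x ≡ β ℤ.+ β ℤ.+ + suc n →
         incAfterOdd (x ∷ applyUpTo (up b n) len) ≡ x ∷ applyUpTo (up b (suc n)) len
inc-up zero    n x β b (s≤s ()) p
inc-up (suc len) n x β b l p with parity n
... | even k rewrite up-odd x β k p | half-even k | half-odd k | up-suc (b 0) k = refl
... | odd k  rewrite up-even x β k p | half-even k | half-odd k =
  cong (x ∷_) (inc-up len k _ (b 0) (b ∘ suc) (suc-double-<⁻ l) refl)

overflow-up : ∀ len n x β b → suc n < pow2 len → x ≡ β ℤ.+ β ℤ.+ + suc n →
         overflowCond (x ∷ applyUpTo (up b n) len) ≡ false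
overflow-up zero    n x β b (s≤s ()) p
overflow-up (suc len) n x β b l p with parity n
... | even k rewrite up-odd x β k p = refl
... | odd k  rewrite up-even x β k p | half-even k | half-odd k =
  overflow-up len k _ (b 0) (b ∘ suc) (suc-double-<⁻ l) refl

allEven-up : ∀ len n x β b → suc n < pow2 len → x ≡ β ℤ.+ β ℤ.+ + suc n →
         allEven (x ∷ applyUpTo (up b n) len) ≡ false
allEven-up zero    n x β b (s≤s ()) p
allEven-up (suc len) n x β b l p with parity n
... | even k rewrite up-odd x β k p = refl
... | odd k  rewrite up-even x β k p | half-even k | half-odd k =
  allEven-up len k _ (b 0) (b ∘ suc) (suc-double-<⁻ l) refl

-- The same carry with the counter running backwards. The parity of the head decides the direction:
-- it is that of the counter here, and that of its successor in `inc-up`.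
inc-down : ∀ len n x β b → suc n < pow2 len → x ≡ β ℤ.+ β ℤ.- + suc n →
         incAfterOdd (x ∷ applyUpTo (down b (suc n)) len) ≡ x ∷ applyUpTo (down b n) len
inc-down zero    n x β b (s≤s ()) p
inc-down (suc len) n x β b l p with parity n
... | even k rewrite down-odd x β k p | half-even k | half-odd k | down-suc (b 0) k = refl
... | odd k rewrite down-even x β k p | half-even k | half-odd k =
  cong (x ∷_) (inc-down len k _ (b 0) (b ∘ suc) (suc-double-<⁻ l) refl)

overflow-down : ∀ len n x β b → suc n < pow2 len → x ≡ β ℤ.+ β ℤ.- + suc n →
         overflowCond (x ∷ applyUpTo (down b (suc n)) len) ≡ false
overflow-down zero    n x β b (s≤s ()) p
overflow-down (suc len) n x β b l p with parity n
... | even k rewrite down-odd x β k p = refl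
... | odd k rewrite down-even x β k p | half-even k | half-odd k =
  overflow-down len k _ (b 0) (b ∘ suc) (suc-double-<⁻ l) refl

allEven-down : ∀ len n x β b → suc n < pow2 len → x ≡ β ℤ.+ β ℤ.- + suc n →
         allEven (x ∷ applyUpTo (down b (suc n)) len) ≡ false
allEven-down zero    n x β b (s≤s ()) p
allEven-down (suc len) n x β b l p with parity n
... | even k rewrite down-odd x β k p = refl
... | odd k rewrite down-even x β k p | half-even k | half-odd k =
  allEven-down len k _ (b 0) (b ∘ suc) (suc-double-<⁻ l) refl

-- Runs and their Increment phases.

-- Runs on reversed states; the index counts the Overflow steps.
infix 4 _⟶[_]_
data _⟶[_]_ : List ℤ → ℕ → List ℤ → Set where
  done : ∀ {r} → r ⟶[ 0 ] r
  step : ∀ {r ρ s n t} → stepRev r ≡ just (ρ , s) → s ⟶[ n ] t →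
         r ⟶[ (if isOverflow ρ then 1 else 0) ℕ.+ n ] t

_⨾_ : ∀ {r m s n t} → r ⟶[ m ] s → s ⟶[ n ] t → r ⟶[ m ℕ.+ n ] t
done ⨾ q = q
_⨾_ {n = n} {t} (step {r} {ρ} {n = m} e p) q =
  subst (λ k → r ⟶[ k ] t) (sym (ℕₚ.+-assoc (if isOverflow ρ then 1 else 0) m n)) (step e (p ⨾ q))

increment : ∀ a r → overflowCond (a ∷ r) ≡ false → allEven (a ∷ r) ≡ false → isMinusOne a ≡ false →
            stepRev (a ∷ r) ≡ just (Increment , decHead (incAfterOdd (a ∷ r)))
increment a r p q s rewrite p | q | s = refl

halve : ∀ x r → -[1+ 0 ] ∷ x ∷ r ⟶[ 0 ] x ∷ r
halve x r = step refl done

-- With the head of a run written as `predℤ d`, the number `d` counts the steps left until the head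
-- is -1 and Halve applies.
predℤ : ℕ → ℤ
predℤ zero    = -[1+ 0 ]
predℤ (suc n) = + n

predℤ-≡ : ∀ n → predℤ n ≡ + n ℤ.- 1ℤ
predℤ-≡ zero    = refl
predℤ-≡ (suc n) = refl

decHead-predℤ : ∀ n r → decHead (+ n ∷ r) ≡ predℤ n ∷ r
decHead-predℤ zero    r = refl
decHead-predℤ (suc n) r = refl

up-step : ∀ len d n β b → suc n < pow2 len → + d ≡ β ℤ.+ β ℤ.+ + suc n →
  predℤ (suc d) ∷ applyUpTo (up b n) len ⟶[ 0 ] predℤ d ∷ applyUpTo (up b (suc n)) len
up-step len d n β b l p = step (trans
  (increment (+ d) (applyUpTo (up b n) len) (overflow-up len n _ β b l p) (allEven-up len n _ β b l p) refl)
  (cong (λ t → just (Increment , t))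
    (trans (cong decHead (inc-up len n _ β b l p)) (decHead-predℤ d (applyUpTo (up b (suc n)) len))))) done

down-step : ∀ len d n β b → suc n < pow2 len → + d ≡ β ℤ.+ β ℤ.- + suc n →
  predℤ (suc d) ∷ applyUpTo (down b (suc n)) len ⟶[ 0 ] predℤ d ∷ applyUpTo (down b n) len
down-step len d n β b l p = step (trans
  (increment (+ d) (applyUpTo (down b (suc n)) len) (overflow-down len n _ β b l p) (allEven-down len n _ β b l p) refl)
  (cong (λ t → just (Increment , t))
    (trans (cong decHead (inc-down len n _ β b l p)) (decHead-predℤ d (applyUpTo (down b n) len))))) done

up-next : ∀ β x n → + suc x ≡ β ℤ.+ β ℤ.+ + suc n → + x ≡ (β ℤ.- 1ℤ) ℤ.+ (β ℤ.- 1ℤ) ℤ.+ + suc (suc n)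
up-next β x n p = trans (lem₁ (+ x)) (trans (cong (ℤ._- 1ℤ) p) (lem₂ β (+ n)))
  where lem₁ : ∀ x → x ≡ 1ℤ ℤ.+ x ℤ.- 1ℤ
        lem₁ = ℤR.solve-∀
        lem₂ : ∀ β n → β ℤ.+ β ℤ.+ (1ℤ ℤ.+ n) ℤ.- 1ℤ ≡ (β ℤ.- 1ℤ) ℤ.+ (β ℤ.- 1ℤ) ℤ.+ (1ℤ ℤ.+ (1ℤ ℤ.+ n))
        lem₂ = ℤR.solve-∀

down-next : ∀ β x n → + suc x ≡ β ℤ.+ β ℤ.- + suc (suc n) → + x ≡ (β ℤ.- 1ℤ) ℤ.+ (β ℤ.- 1ℤ) ℤ.- + suc n
down-next β x n p = trans (lem₁ (+ x)) (trans (cong (ℤ._- 1ℤ) p) (lem₂ β (+ n)))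
  where lem₁ : ∀ x → x ≡ 1ℤ ℤ.+ x ℤ.- 1ℤ
        lem₁ = ℤR.solve-∀
        lem₂ : ∀ β n → β ℤ.+ β ℤ.- (1ℤ ℤ.+ (1ℤ ℤ.+ n)) ℤ.- 1ℤ ≡ (β ℤ.- 1ℤ) ℤ.+ (β ℤ.- 1ℤ) ℤ.- (1ℤ ℤ.+ n)
        lem₂ = ℤR.solve-∀

up-run : ∀ len t d n β b → t ℕ.+ n < pow2 len → predℤ (t ℕ.+ d) ≡ β ℤ.+ β ℤ.+ + suc n →
  predℤ (t ℕ.+ d) ∷ applyUpTo (up b n) len ⟶[ 0 ] predℤ d ∷ applyUpTo (up b (t ℕ.+ n)) len
up-run len zero    d n β b l p = done
up-run len (suc zero) d n β b l p = up-step len d n β b l p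
up-run len (suc (suc t)) d n β b l p =
  up-step len (suc t ℕ.+ d) n β b (ℕₚ.≤-<-trans (s≤s (ℕₚ.m≤n+m n (suc t))) l) p
  ⨾ subst (λ k → predℤ (suc t ℕ.+ d) ∷ applyUpTo (up b (suc n)) len ⟶[ 0 ] predℤ d ∷ applyUpTo (up b k) len)
      (ℕₚ.+-suc (suc t) n)
      -- The head falls by 1 while the counter rises by 1, so lowering `β` by 1 preserves the parity
      -- relation.
      (up-run len (suc t) d (suc n) (β ℤ.- 1ℤ) b (subst (_< pow2 len) (sym (ℕₚ.+-suc (suc t) n)) l)
        (up-next β (t ℕ.+ d) n p))

down-run : ∀ len t d n β b → t ℕ.+ n < pow2 len → predℤ (t ℕ.+ d) ≡ β ℤ.+ β ℤ.- + (t ℕ.+ n) →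
  predℤ (t ℕ.+ d) ∷ applyUpTo (down b (t ℕ.+ n)) len ⟶[ 0 ] predℤ d ∷ applyUpTo (down b n) len
down-run len zero    d n β b l p = done
down-run len (suc zero) d n β b l p = down-step len d n β b l p
down-run len (suc (suc t)) d n β b l p =
  down-step len (suc t ℕ.+ d) (suc t ℕ.+ n) β b l p
  ⨾ down-run len (suc t) d n (β ℤ.- 1ℤ) b (ℕₚ.<-trans (ℕₚ.n<1+n _) l) (down-next β (t ℕ.+ d) (t ℕ.+ n) p)

-- Mersenne numbers 2^n - 1 as full counters, and reflection.

mers : ℕ → ℕ
mers zero    = 0
mers (suc n) = suc (mers n ℕ.+ mers n)

suc-mers : ∀ n → suc (mers n) ≡ pow2 n
suc-mers zero    = refl
suc-mers (suc n) = trans (cong suc (sym (ℕₚ.+-suc (mers n) (mers n)))) (cong₂ ℕ._+_ (suc-mers n) (suc-mers n))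

-- 2^(l − 1 − i) for i < l, and 0 beyond.
pw : ℕ → ℕ → ℕ
pw zero    _       = 0
pw (suc l) zero    = pow2 l
pw (suc l) (suc i) = pw l i

D-mers : ∀ l i → D (mers l) i ≡ pw l i
D-mers zero    zero    = refl
D-mers zero    (suc i) = D-mers zero i
D-mers (suc l) zero    rewrite half-even (mers l) = suc-mers l
D-mers (suc l) (suc i) rewrite half-odd (mers l)  = D-mers l i

D-zero : ∀ i → D 0 i ≡ 0
D-zero zero    = refl
D-zero (suc i) = D-zero i

double-injective : ∀ {a b} → a ℕ.+ a ≡ b ℕ.+ b → a ≡ b
double-injective {a} {b} p = trans (sym (half-even a)) (trans (cong ⌊_/2⌋ p) (half-even b))

even≢odd : ∀ a b → a ℕ.+ a ≢ suc (b ℕ.+ b)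
even≢odd (suc a) b p =
  even≢odd b a (sym (ℕₚ.suc-injective (trans (cong suc (sym (ℕₚ.+-suc a a))) p)))

-- The reflection m ↦ 2^a − m preserves 2-adic valuations.
D-complement : ∀ a c n → c ℕ.+ n ≡ mers a → ∀ i → D c i ℕ.+ D n i ≡ pw a i
D-complement zero zero zero p i rewrite D-zero i = refl
D-complement (suc a) c n p i with parity c | parity n
... | even c′ | even n′ = ⊥-elim (even≢odd (c′ ℕ.+ n′) (mers a) (trans (eq c′ n′) p))
  where eq : ∀ c n → (c ℕ.+ n) ℕ.+ (c ℕ.+ n) ≡ (c ℕ.+ c) ℕ.+ (n ℕ.+ n)
        eq = ℕR.solve-∀
... | odd c′ | odd n′ = ⊥-elim (even≢odd (suc c′ ℕ.+ n′) (mers a) (trans (eq c′ n′) p))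
  where eq : ∀ c n → (suc c ℕ.+ n) ℕ.+ (suc c ℕ.+ n) ≡ suc (c ℕ.+ c) ℕ.+ suc (n ℕ.+ n)
        eq = ℕR.solve-∀
... | even c′ | odd n′ = go i
  where
  eq : ∀ c n → suc ((c ℕ.+ n) ℕ.+ (c ℕ.+ n)) ≡ (c ℕ.+ c) ℕ.+ suc (n ℕ.+ n)
  eq = ℕR.solve-∀
  sum : c′ ℕ.+ n′ ≡ mers a
  sum = double-injective (ℕₚ.suc-injective (trans (eq c′ n′) p))
  go : ∀ i → D (c′ ℕ.+ c′) i ℕ.+ D (suc (n′ ℕ.+ n′)) i ≡ pw (suc a) i
  go zero    rewrite half-odd c′ | half-even n′ = trans (ℕₚ.+-suc c′ n′) (trans (cong suc sum) (suc-mers a))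
  go (suc i) rewrite half-even c′ | half-odd n′ = D-complement a c′ n′ sum i
... | odd c′ | even n′ = go i
  where
  eq : ∀ c n → suc ((c ℕ.+ n) ℕ.+ (c ℕ.+ n)) ≡ suc (c ℕ.+ c) ℕ.+ (n ℕ.+ n)
  eq = ℕR.solve-∀
  sum : c′ ℕ.+ n′ ≡ mers a
  sum = double-injective (ℕₚ.suc-injective (trans (eq c′ n′) p))
  go : ∀ i → D (suc (c′ ℕ.+ c′)) i ℕ.+ D (n′ ℕ.+ n′) i ≡ pw (suc a) i
  go zero    rewrite half-even c′ | half-odd n′ = trans (cong suc sum) (suc-mers a)
  go (suc i) rewrite half-odd c′ | half-even n′ = D-complement a c′ n′ sum i

-- Half of pw, rounded up.
halfPw : ℕ → ℕ → ℕ
halfPw zero          _       = 0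
halfPw (suc zero)    zero    = 1
halfPw (suc (suc l)) zero    = pow2 l
halfPw (suc l)       (suc i) = halfPw l i

-- What is left of the shift `halfPw` once the reflection total `pw` of `D-complement` is taken off.
κ : ℕ → ℕ → ℕ
κ zero                _       = 0
κ (suc zero)          zero    = 1
κ (suc (suc zero))    zero    = 1
κ (suc (suc (suc l))) zero    = pow2 l
κ (suc l)             (suc i) = κ l i

κ+pw≡halfPw : ∀ l i → κ (suc l) i ℕ.+ pw l (suc i) ≡ halfPw (suc l) i
κ+pw≡halfPw zero          zero    = refl
κ+pw≡halfPw (suc zero)    zero    = refl
κ+pw≡halfPw (suc (suc l)) zero    = refl
κ+pw≡halfPw zero          (suc i) = refl
κ+pw≡halfPw (suc zero)    (suc i) = κ+pw≡halfPw zero i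
κ+pw≡halfPw (suc (suc l)) (suc i) = κ+pw≡halfPw (suc l) i

twice : ℤ → ℤ
twice x = x ℤ.+ x

applyUpTo-cong : ∀ {f g : ℕ → ℤ} → (∀ i → f i ≡ g i) → ∀ n → applyUpTo f n ≡ applyUpTo g n
applyUpTo-cong eq zero    = refl
applyUpTo-cong eq (suc n) = cong₂ _∷_ (eq 0) (applyUpTo-cong (eq ∘ suc) n)

allEven-double : ∀ n g → allEven (applyUpTo (twice ∘ g) n) ≡ true
allEven-double zero    g = refl
allEven-double (suc n) g rewrite isOdd-even (g 0) = allEven-double n (g ∘ suc)

overflow-double : ∀ n x g → overflowCond (twice x ∷ applyUpTo (twice ∘ g) n) ≡ false
overflow-double zero    x g = isOdd-even x
overflow-double (suc n) x g rewrite isOdd-even x = overflow-double n (g 0) (g ∘ suc)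

topTwoZero-false : ∀ n x f → isZero (f n) ≡ false → topTwoZero (x ∷ applyUpTo f (2 ℕ.+ n)) ≡ false
topTwoZero-false zero    x f p rewrite p = refl
topTwoZero-false (suc n) x f p = topTwoZero-false n (f 0) (f ∘ suc) p

-- Below the top `pw` is twice `halfPw`, so those entries already are the Gray code at a full
-- counter. At the top, rounding up makes `halfPw` 1 instead of 1/2, and the +1 of the Zero rule
-- repairs this. The two new entries have count 0.
zeroTop-double : ∀ n x (h : ℕ → ℕ) → h (1 ℕ.+ n) ≡ 0 → h (2 ℕ.+ n) ≡ 0 →
  zeroTop (x ∷ applyUpTo (λ i → twice (+ h i ℤ.- + halfPw (1 ℕ.+ n) i)) (1 ℕ.+ n))
  ≡ x ∷ applyUpTo (down (λ i → + h i) (mers (1 ℕ.+ n))) (3 ℕ.+ n)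
zeroTop-double zero    x h p q rewrite p | q = cong (λ t → x ∷ t ∷ 0ℤ ∷ 0ℤ ∷ []) (eq (+ h 0))
  where eq : ∀ h → (h ℤ.- 1ℤ) ℤ.+ (h ℤ.- 1ℤ) ℤ.+ 1ℤ ≡ h ℤ.+ h ℤ.- 1ℤ
        eq = ℤR.solve-∀
zeroTop-double (suc n) x h p q = cong (x ∷_) (trans (zeroTop-double n _ (h ∘ suc) p q)
  (cong₂ _∷_ head-eq (cong (λ t → applyUpTo (down (λ i → + h (suc i)) t) (3 ℕ.+ n)) (sym (half-odd m)))))
  where
  m = mers (suc n)
  eq : ∀ h p → (h ℤ.- p) ℤ.+ (h ℤ.- p) ≡ h ℤ.+ h ℤ.- (p ℤ.+ p)
  eq = ℤR.solve-∀
  head-eq : twice (+ h 0 ℤ.- + pow2 n) ≡ + h 0 ℤ.+ + h 0 ℤ.- + suc ⌊ m ℕ.+ m /2⌋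
  head-eq = trans (eq (+ h 0) (+ pow2 n)) (cong (λ t → + h 0 ℤ.+ + h 0 ℤ.- + t)
    (sym (trans (cong suc (half-even m)) (suc-mers (suc n)))))

-- The passage between two consecutive all-even states.

module Level (e : ℕ) where

  L : ℕ
  L = 2 ℕ.+ e

  -- `vanish` supplies the two zeros that the Zero rule adds; `top` makes the second entry from the
  -- left nonzero, which excludes Halt.
  record Good (X : ℕ → ℕ) : Set where
    field
      vanish : ∀ j → X (suc L ℕ.+ j) ≡ 0
      top    : 2 ≤ X (suc e)

  -- X holds the halves of the entries of the all-even state E X, all but the
  -- first shifted by halfPw; Q X is the successor under Zero.  The shift turns
  -- those of Q X into 2X − D (2^L − 1), that is, into a Gray code at 2^L − 1.
  E : (ℕ → ℕ) → List ℤ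
  E X = twice (+ X 0) ∷ applyUpTo (λ i → twice (+ X (suc i) ℤ.- + halfPw L i)) L

  Q : (ℕ → ℕ) → List ℤ
  Q X = predℤ (X 0 ℕ.+ X 0) ∷ applyUpTo (down (λ i → + X (suc i)) (mers L)) (2 ℕ.+ L)

  halfPw-top : ∀ n → halfPw (2 ℕ.+ n) n ≡ 1
  halfPw-top zero    = refl
  halfPw-top (suc n) = halfPw-top n

  zero-step : ∀ X → Good X → E X ⟶[ 0 ] Q X
  zero-step X g = step {ρ = Zero} eq done
    where
    open Good g
    f : ℕ → ℤ
    f i = + X (suc i) ℤ.- + halfPw L i
    nz : ∀ x → 2 ≤ x → isZero (twice (+ x ℤ.- 1ℤ)) ≡ false
    nz (suc (suc x)) _ = refl
    nz (suc zero) (s≤s ())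
    ttz : topTwoZero (E X) ≡ false
    ttz = topTwoZero-false e (twice (+ X 0)) (twice ∘ f)
      (trans (cong (λ t → isZero (twice (+ X (suc e) ℤ.- + t))) (halfPw-top e)) (nz _ top))
    v₀ : X (suc (2 ℕ.+ e)) ≡ 0
    v₀ = trans (cong (X ∘ suc ∘ suc ∘ suc) (sym (ℕₚ.+-identityʳ e))) (vanish 0)
    v₁ : X (suc (3 ℕ.+ e)) ≡ 0
    v₁ = trans (cong (X ∘ suc ∘ suc ∘ suc) (sym (ℕₚ.+-comm e 1))) (vanish 1)
    eq : stepRev (E X) ≡ just (Zero , Q X)
    eq rewrite overflow-double L (+ X 0) f | isOdd-even (+ X 0) | allEven-double L f | ttz =
      cong (λ t → just (Zero , t)) (trans
        (cong decHead (zeroTop-double (suc e) (twice (+ X 0)) (X ∘ suc) v₀ v₁))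
        (decHead-predℤ (X 0 ℕ.+ X 0) _))

  -- The constants that remain when `D n` is replaced by `pw (suc e)` minus `D (X 0)`: the
  -- reflection total at coordinate 0, and its combination with the shift elsewhere.
  sub add : ℕ → ℕ
  sub zero    = pow2 e
  sub (suc i) = 0
  add zero    = 0
  add (suc i) = κ L i

  D⁺ : ℕ → ℕ → ℕ
  D⁺ z zero    = 0
  D⁺ z (suc i) = D z i

  rhs : ℕ → ℕ → (ℕ → ℕ) → ℕ → ℕ
  rhs c z X i = X (2 ℕ.+ i) ℕ.+ add i ℕ.+ D c i ℕ.+ D⁺ z i

  -- The map from one all-even state to the next; sub is on the left because
  -- natural subtraction truncates.
  G : (ℕ → ℕ) → (ℕ → ℕ) → Set
  G X Y = ∀ i → Y i ℕ.+ sub i ≡ rhs (X 0) (X 1) X i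

  -- The head 2X₀ - 1 and the counter 2^L - 1 are both odd, so the counter descends, by 2X₀ steps,
  -- to 2n + 1. Halve then drops the -1 and halves the counter to n.
  first-descent : ∀ X n → X 0 ℕ.+ n ≡ mers (suc e) →
    Q X ⟶[ 0 ] (+ X 1 ℤ.+ + X 1 ℤ.- + suc n) ∷ applyUpTo (down (λ i → + X (2 ℕ.+ i)) n) (3 ℕ.+ e)
  first-descent X n p =
    subst₂ (λ a b → predℤ a ∷ applyUpTo (down h b) (4 ℕ.+ e) ⟶[ 0 ] target) (ℕₚ.+-identityʳ _) total
      (down-run (4 ℕ.+ e) (c ℕ.+ c) 0 (suc (n ℕ.+ n)) (+ c ℤ.+ (+ c ℤ.+ + n)) h bound par
       ⨾ subst₂ (λ a b → predℤ 0 ∷ applyUpTo (down h (suc (n ℕ.+ n))) (4 ℕ.+ e) ⟶[ 0 ]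
             (+ X 1 ℤ.+ + X 1 ℤ.- + suc a) ∷ applyUpTo (down (h ∘ suc) b) (3 ℕ.+ e))
           (half-even n) (half-odd n) (halve _ _))
    where
    c = X 0
    h : ℕ → ℤ
    h i = + X (suc i)
    target : List ℤ
    target = (+ X 1 ℤ.+ + X 1 ℤ.- + suc n) ∷ applyUpTo (down (h ∘ suc) n) (3 ℕ.+ e)
    eq : ∀ c n → (c ℕ.+ c) ℕ.+ suc (n ℕ.+ n) ≡ suc ((c ℕ.+ n) ℕ.+ (c ℕ.+ n))
    eq = ℕR.solve-∀
    total : (c ℕ.+ c) ℕ.+ suc (n ℕ.+ n) ≡ mers L
    total = trans (eq c n) (cong (λ t → suc (t ℕ.+ t)) p)
    bound : (c ℕ.+ c) ℕ.+ suc (n ℕ.+ n) < pow2 (4 ℕ.+ e)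
    bound = ℕₚ.≤-trans (ℕₚ.≤-reflexive (trans (cong suc total) (suc-mers L)))
             (ℕₚ.≤-trans (ℕₚ.m≤m+n _ _) (ℕₚ.m≤m+n _ _))
    eqz : ∀ c n → (c ℤ.+ c) ℤ.- 1ℤ ≡ (c ℤ.+ (c ℤ.+ n)) ℤ.+ (c ℤ.+ (c ℤ.+ n)) ℤ.- ((c ℤ.+ c) ℤ.+ (1ℤ ℤ.+ (n ℤ.+ n)))
    eqz = ℤR.solve-∀
    par : predℤ (c ℕ.+ c ℕ.+ 0) ≡ (+ c ℤ.+ (+ c ℤ.+ + n)) ℤ.+ (+ c ℤ.+ (+ c ℤ.+ + n)) ℤ.- + ((c ℕ.+ c) ℕ.+ suc (n ℕ.+ n))
    par = trans (trans (cong predℤ (ℕₚ.+-identityʳ _)) (predℤ-≡ _)) (eqz (+ c) (+ n))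

  -- The head now has the parity of n + 1, so the direction reverses. Rebased at `h − D n`, the same
  -- entries are ascending ones; after 2z - n steps the counter is 2z, and Halve turns it into z.
  ascent : ∀ z n (h : ℕ → ℤ) → n ≤ z ℕ.+ z → z < pow2 L →
    (+ z ℤ.+ + z ℤ.- + suc n) ∷ applyUpTo (down h n) (3 ℕ.+ e) ⟶[ 0 ]
    (h 0 ℤ.- + D n 0 ℤ.+ (h 0 ℤ.- + D n 0) ℤ.+ + z) ∷ applyUpTo (up (λ i → h (suc i) ℤ.- + D n (suc i)) z) L
  ascent z n h n≤ z< =
    subst₂ (λ a b → a ∷ b ⟶[ 0 ] target) (sym head-eq) (applyUpTo-cong (λ i → eqb (h i) (+ D n i)) (3 ℕ.+ e))
     (up-run (3 ℕ.+ e) t 0 n (+ z ℤ.- + n ℤ.- 1ℤ) b bound par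
      ⨾ subst (λ k → predℤ 0 ∷ applyUpTo (up b k) (3 ℕ.+ e) ⟶[ 0 ] target) (sym total)
        (subst₂ (λ u v → predℤ 0 ∷ applyUpTo (up b (z ℕ.+ z)) (3 ℕ.+ e) ⟶[ 0 ]
             (b 0 ℤ.+ b 0 ℤ.+ + u) ∷ applyUpTo (up (b ∘ suc) v) (2 ℕ.+ e)) (half-odd z) (half-even z)
           (halve _ _)))
    where
    t = z ℕ.+ z ℕ.∸ n
    b : ℕ → ℤ
    b i = h i ℤ.- + D n i
    target : List ℤ
    target = (b 0 ℤ.+ b 0 ℤ.+ + z) ∷ applyUpTo (up (b ∘ suc) z) L
    eqb : ∀ h d → (h ℤ.- d) ℤ.+ (h ℤ.- d) ℤ.+ d ≡ h ℤ.+ h ℤ.- d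
    eqb = ℤR.solve-∀
    total : t ℕ.+ n ≡ z ℕ.+ z
    total = ℕₚ.m∸n+n≡m n≤
    bound : t ℕ.+ n < pow2 (3 ℕ.+ e)
    bound = subst (_< pow2 (3 ℕ.+ e)) (sym total) (ℕₚ.+-mono-< z< z<)
    eqh : ∀ t n → (t ℤ.+ n) ℤ.- (1ℤ ℤ.+ n) ≡ t ℤ.- 1ℤ
    eqh = ℤR.solve-∀
    head-eq : + z ℤ.+ + z ℤ.- + suc n ≡ predℤ (t ℕ.+ 0)
    head-eq = trans (cong (λ k → + k ℤ.- + suc n) (sym total))
      (trans (eqh (+ t) (+ n)) (trans (sym (predℤ-≡ t)) (cong predℤ (sym (ℕₚ.+-identityʳ t)))))
    eqp : ∀ z n → z ℤ.+ z ℤ.- (1ℤ ℤ.+ n) ≡ (z ℤ.- n ℤ.- 1ℤ) ℤ.+ (z ℤ.- n ℤ.- 1ℤ) ℤ.+ (1ℤ ℤ.+ n)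
    eqp = ℤR.solve-∀
    par : predℤ (t ℕ.+ 0) ≡ (+ z ℤ.- + n ℤ.- 1ℤ) ℤ.+ (+ z ℤ.- + n ℤ.- 1ℤ) ℤ.+ + suc n
    par = trans (sym head-eq) (eqp (+ z) (+ n))

  -- The head has the parity of z, which reverses the direction again. Rebased at `b + D z`, the
  -- counter descends to 0, where every entry is even.
  second-descent : ∀ z a (b : ℕ → ℤ) → z < pow2 L →
    (+ a ℤ.+ + a ℤ.+ + z) ∷ applyUpTo (up b z) L ⟶[ 0 ]
    twice (+ a) ∷ applyUpTo (λ i → twice (b i ℤ.+ + D z i)) L
  second-descent z a b z< =
    subst₂ (λ u v → u ⟶[ 0 ] v)
      (cong₂ _∷_ (trans (predℤ-≡ (z ℕ.+ suc (a ℕ.+ a))) (eqh (+ a) (+ z)))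
        (trans (cong (λ k → applyUpTo (down h k) L) (ℕₚ.+-identityʳ z)) (applyUpTo-cong (λ i → eqb (b i) (+ D z i)) L)))
      (cong (twice (+ a) ∷_) (applyUpTo-cong eq₀ L))
      (down-run L z (suc (a ℕ.+ a)) 0 (+ a ℤ.+ + z) h (subst (_< pow2 L) (sym (ℕₚ.+-identityʳ z)) z<) par)
    where
    h : ℕ → ℤ
    h i = b i ℤ.+ + D z i
    eqh : ∀ a z → z ℤ.+ (1ℤ ℤ.+ (a ℤ.+ a)) ℤ.- 1ℤ ≡ a ℤ.+ a ℤ.+ z
    eqh = ℤR.solve-∀
    eqb : ∀ b d → (b ℤ.+ d) ℤ.+ (b ℤ.+ d) ℤ.- d ≡ b ℤ.+ b ℤ.+ d
    eqb = ℤR.solve-∀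
    eq₀ : ∀ i → down h 0 i ≡ twice (h i)
    eq₀ i rewrite D-zero i = ℤₚ.+-identityʳ _
    eqp : ∀ a z → a ℤ.+ a ℤ.+ z ≡ (a ℤ.+ z) ℤ.+ (a ℤ.+ z) ℤ.- z
    eqp = ℤR.solve-∀
    par : predℤ (z ℕ.+ suc (a ℕ.+ a)) ≡ (+ a ℤ.+ + z) ℤ.+ (+ a ℤ.+ + z) ℤ.- + (z ℕ.+ 0)
    par = trans (trans (predℤ-≡ (z ℕ.+ suc (a ℕ.+ a))) (eqh (+ a) (+ z)))
      (trans (eqp (+ a) (+ z)) (cong (λ k → (+ a ℤ.+ + z) ℤ.+ (+ a ℤ.+ + z) ℤ.- + k) (sym (ℕₚ.+-identityʳ z))))

  -- The three phases are joined and n is eliminated by `D-complement`. The first two bounds make n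
  -- exist and be at most 2X₁; the third lets the ascending counter reach 2X₁ without an Overflow.
  cycle : ∀ X Y → Good X → G X Y → X 0 < pow2 (suc e) → pow2 e ≤ X 1 → X 1 < pow2 L → E X ⟶[ 0 ] E Y
  cycle X Y g G c< ≤z z< =
    zero-step X g ⨾ (first-descent X n sum ⨾ (ascent (X 1) n (λ i → + X (2 ℕ.+ i)) n≤ z< ⨾
      subst₂ (λ u v → u ∷ applyUpTo (up b (X 1)) L ⟶[ 0 ] twice (+ Y 0) ∷ v)
        (cong (λ t → t ℤ.+ t ℤ.+ + X 1) head-eq)
        (applyUpTo-cong (λ i → cong twice (rest-eq i)) L)
        (second-descent (X 1) (Y 0) b z<)))
    where
    m = mers (suc e)
    n = m ℕ.∸ X 0
    c≤ : X 0 ≤ m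
    c≤ = ℕₚ.≤-pred (subst (X 0 <_) (sym (suc-mers (suc e))) c<)
    sum : X 0 ℕ.+ n ≡ m
    sum = ℕₚ.m+[n∸m]≡n c≤
    n≤ : n ≤ X 1 ℕ.+ X 1
    n≤ = ℕₚ.≤-trans (ℕₚ.m∸n≤m m (X 0)) (ℕₚ.≤-trans (ℕₚ.n≤1+n m)
           (ℕₚ.≤-trans (ℕₚ.≤-reflexive (suc-mers (suc e))) (ℕₚ.+-mono-≤ ≤z ≤z)))
    b : ℕ → ℤ
    b i = + X (3 ℕ.+ i) ℤ.- + D n (suc i)
    head-eq : + Y 0 ≡ + X 2 ℤ.- + D n 0
    head-eq = lem (+ Y 0) (+ pow2 e) (+ X 2) (+ D (X 0) 0) (+ D n 0)
        (cong +_ (trans (G 0) (trans (ℕₚ.+-identityʳ _) (cong (ℕ._+ D (X 0) 0) (ℕₚ.+-identityʳ _)))))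
        (cong +_ (D-complement (suc e) (X 0) n sum 0))
      where
      lem : ∀ y p x d d′ → y ℤ.+ p ≡ x ℤ.+ d → d ℤ.+ d′ ≡ p → y ≡ x ℤ.- d′
      lem y p x d d′ q refl = trans (r₁ y d d′) (trans (cong (ℤ._- (d ℤ.+ d′)) q) (r₂ x d d′))
        where r₁ : ∀ y d d′ → y ≡ y ℤ.+ (d ℤ.+ d′) ℤ.- (d ℤ.+ d′)
              r₁ = ℤR.solve-∀
              r₂ : ∀ x d d′ → x ℤ.+ d ℤ.- (d ℤ.+ d′) ≡ x ℤ.- d′
              r₂ = ℤR.solve-∀
    rest-eq : ∀ i → b i ℤ.+ + D (X 1) i ≡ + Y (suc i) ℤ.- + halfPw L i
    rest-eq i = lem (+ Y (suc i)) (+ X (3 ℕ.+ i)) (+ κ L i) (+ D (X 0) (suc i)) (+ D n (suc i)) (+ D (X 1) i) _ _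
        (cong +_ (trans (sym (ℕₚ.+-identityʳ _)) (G (suc i))))
        (cong +_ (D-complement (suc e) (X 0) n sum (suc i)))
        (cong +_ (κ+pw≡halfPw (suc e) i))
      where
      lem : ∀ y x k d d′ dz p h → y ≡ x ℤ.+ k ℤ.+ d ℤ.+ dz → d ℤ.+ d′ ≡ p → k ℤ.+ p ≡ h → x ℤ.- d′ ℤ.+ dz ≡ y ℤ.- h
      lem y x k d d′ dz p h refl refl refl = r x k d d′ dz
        where r : ∀ x k d d′ dz → x ℤ.- d′ ℤ.+ dz ≡ x ℤ.+ k ℤ.+ d ℤ.+ dz ℤ.- (k ℤ.+ (d ℤ.+ d′))
              r = ℤR.solve-∀

-- 2-adic valuations.

δ : ℕ → ℕ → ℕ
δ zero    zero    = 1
δ zero    (suc i) = 0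
δ (suc v) zero    = 0
δ (suc v) (suc i) = δ v i

δ-< : ∀ {v i} → v < i → δ v i ≡ 0
δ-< {zero}  (s≤s p) = refl
δ-< {suc v} (s≤s p) = δ-< p

data Valuation : ℕ → ℕ → Set where
  odd-part  : ∀ q → Valuation 0 (suc (q ℕ.+ q))
  double : ∀ {v n} → Valuation v n → Valuation (suc v) (n ℕ.+ n)

Valuation-zero : ∀ {v n} → n ≡ 0 → Valuation v n → ∀ {A : Set} → A
Valuation-zero () (odd-part q)
Valuation-zero {n = n} p (double {n = zero} w) = Valuation-zero refl w

Valuation-exists : ∀ a n → n < a → Σ ℕ λ v → Valuation v (suc n)
Valuation-exists (suc a) n (s≤s p) with parity n
... | even k = 0 , odd-part k
... | odd k with Valuation-exists a k (ℕₚ.≤-trans (s≤s (ℕₚ.m≤m+n k k)) p)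
...   | v , w = suc v , subst (Valuation (suc v)) (cong suc (ℕₚ.+-suc k k)) (double w)

Valuation-< : ∀ {v n} a → Valuation v n → n < pow2 a → v < a
Valuation-< zero    (odd-part q) (s≤s ())
Valuation-< (suc a) (odd-part q) p = s≤s z≤n
Valuation-< zero    (double {n = zero} w) p = Valuation-zero refl w
Valuation-< zero    (double {n = suc n} w) (s≤s ())
Valuation-< (suc a) (double w) p = s≤s (Valuation-< a w (double-<⁻ p))

Valuation-pow2 : ∀ a → Valuation a (pow2 a)
Valuation-pow2 zero    = odd-part 0
Valuation-pow2 (suc a) = double (Valuation-pow2 a)

-- The lowest set bit is unaffected by a new bit above all others. This gives X₀ and X₁ equal
-- valuations at corresponding points of the sweep.
Valuation-+pow2 : ∀ {v n} a → Valuation v n → n < pow2 a → Valuation v (n ℕ.+ pow2 a)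
Valuation-+pow2 zero (odd-part q) (s≤s ())
Valuation-+pow2 (suc a) (odd-part q) p = subst (Valuation 0) (eq q (pow2 a)) (odd-part (q ℕ.+ pow2 a))
  where eq : ∀ q w → suc ((q ℕ.+ w) ℕ.+ (q ℕ.+ w)) ≡ suc (q ℕ.+ q) ℕ.+ (w ℕ.+ w)
        eq = ℕR.solve-∀
Valuation-+pow2 zero    (double {n = zero} w) p = Valuation-zero refl w
Valuation-+pow2 zero    (double {n = suc n} w) (s≤s ())
Valuation-+pow2 (suc a) (double {v} {n} w) p =
  subst (Valuation (suc v)) (eq n (pow2 a)) (double (Valuation-+pow2 a w (double-<⁻ p)))
  where eq : ∀ q w → (q ℕ.+ w) ℕ.+ (q ℕ.+ w) ≡ (q ℕ.+ q) ℕ.+ (w ℕ.+ w)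
        eq = ℕR.solve-∀

D-suc : ∀ {v k} n → Valuation v k → k ≡ suc n → ∀ i → D (suc n) i ≡ D n i ℕ.+ δ v i
D-suc n (odd-part q) refl zero    rewrite half-even q | half-odd q = ℕₚ.+-comm 1 q
D-suc n (odd-part q) refl (suc i) rewrite half-even q | half-odd q = sym (ℕₚ.+-identityʳ _)
D-suc n (double {n = zero} w) () i
D-suc n (double {n = suc m} w) refl zero rewrite ℕₚ.+-suc m m | half-even m | half-odd m = sym (ℕₚ.+-identityʳ _)
D-suc n (double {n = suc m} w) refl (suc i) rewrite ℕₚ.+-suc m m | half-even m | half-odd m = D-suc m w refl i

quad : ℕ → ℕ
quad t = (t ℕ.+ t) ℕ.+ (t ℕ.+ t)

Val₁ : ∀ t → Valuation 0 (1 ℕ.+ quad t)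
Val₁ t = odd-part (t ℕ.+ t)

Val₂ : ∀ t → Valuation 1 (2 ℕ.+ quad t)
Val₂ t = subst (Valuation 1) (eq t) (double (odd-part t))
  where eq : ∀ t → suc (t ℕ.+ t) ℕ.+ suc (t ℕ.+ t) ≡ 2 ℕ.+ ((t ℕ.+ t) ℕ.+ (t ℕ.+ t))
        eq = ℕR.solve-∀

Val₃ : ∀ t → Valuation 0 (3 ℕ.+ quad t)
Val₃ t = subst (Valuation 0) (eq t) (odd-part (suc (t ℕ.+ t)))
  where eq : ∀ t → suc (suc (t ℕ.+ t) ℕ.+ suc (t ℕ.+ t)) ≡ 3 ℕ.+ ((t ℕ.+ t) ℕ.+ (t ℕ.+ t))
        eq = ℕR.solve-∀

quad-suc : ∀ t → quad (suc t) ≡ 4 ℕ.+ quad t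
quad-suc = eq
  where eq : ∀ t → (suc t ℕ.+ suc t) ℕ.+ (suc t ℕ.+ suc t) ≡ 4 ℕ.+ ((t ℕ.+ t) ℕ.+ (t ℕ.+ t))
        eq = ℕR.solve-∀

quad-+ : ∀ s t → quad (s ℕ.+ t) ≡ quad s ℕ.+ quad t
quad-+ = eq
  where eq : ∀ s t → ((s ℕ.+ t) ℕ.+ (s ℕ.+ t)) ℕ.+ ((s ℕ.+ t) ℕ.+ (s ℕ.+ t))
             ≡ ((s ℕ.+ s) ℕ.+ (s ℕ.+ s)) ℕ.+ ((t ℕ.+ t) ℕ.+ (t ℕ.+ t))
        eq = ℕR.solve-∀

Val₄ : ∀ {v} t → Valuation v (suc t) → Valuation (2 ℕ.+ v) (4 ℕ.+ quad t)
Val₄ {v} t w = subst (Valuation (2 ℕ.+ v)) (quad-suc t) (double (double w))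

Val₅ : ∀ t → Valuation 0 (5 ℕ.+ quad t)
Val₅ t = subst (Valuation 0 ∘ suc) (quad-suc t) (Val₁ (suc t))

Val₆ : ∀ t → Valuation 1 (6 ℕ.+ quad t)
Val₆ t = subst (Valuation 1 ∘ suc ∘ suc) (quad-suc t) (Val₂ (suc t))

-- Single-coordinate increments and handovers between X₀ and X₁.

module Path (e : ℕ) where
  open Level e

  infixl 6 _⊕_
  _⊕_ : (ℕ → ℕ) → ℕ → (ℕ → ℕ)
  (X ⊕ p) i = δ p i ℕ.+ X i

  ⊕-Good : ∀ {X p} → p ≤ L → Good X → Good (X ⊕ p)
  ⊕-Good {X} {p} p≤ g = record
    { vanish = λ j → trans (cong (ℕ._+ X (suc L ℕ.+ j)) (δ-< (s≤s (ℕₚ.≤-trans p≤ (ℕₚ.m≤m+n L j))))) (vanish j)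
    ; top    = ℕₚ.≤-trans top (ℕₚ.m≤n+m _ (δ p (suc e))) }
    where open Good g

  -- `X` would be its own image under `G` if its first two coordinates were `c` and `z`.
  Fix : ℕ → ℕ → (ℕ → ℕ) → Set
  Fix c z X = ∀ i → X i ℕ.+ sub i ≡ rhs c z X i

  -- Coordinate 0 (TA) or 1 (TB) has just been incremented; the Fix equations
  -- then determine all coordinates from c and z.
  TA TB : ℕ → ℕ → (ℕ → ℕ) → Set
  TA c z X = X 0 ≡ suc c × X 1 ≡ z × Fix c z X
  TB c z X = X 0 ≡ c × X 1 ≡ suc z × Fix c z X

  -- The increments p, p - 2, ... end at coordinate 0 or 1 according to the parity of p.
  Tp : ℕ → ℕ → ℕ → (ℕ → ℕ) → Set
  Tp zero          = TA
  Tp (suc zero)    = TB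
  Tp (suc (suc p)) = Tp p

  Tp-alternates : ∀ v → (Tp (suc v) ≡ TB × Tp v ≡ TA) ⊎ (Tp (suc v) ≡ TA × Tp v ≡ TB)
  Tp-alternates zero    = inj₁ (refl , refl)
  Tp-alternates (suc v) with Tp-alternates v
  ... | inj₁ (p , q) = inj₂ (q , p)
  ... | inj₂ (p , q) = inj₁ (q , p)

  Bounded : ℕ → ℕ → Set
  Bounded c z = c < pow2 (suc e) × pow2 e ≤ z × z < pow2 L

  -- G shifts the coordinates by two, so after adding δ (2 + p) it adds δ p.
  chain : ∀ p X → p ≤ L → Good X → Bounded (X 0) (X 1) → G X (X ⊕ p) →
    Σ (ℕ → ℕ) λ Y → (E X ⟶[ 0 ] E Y) × Good Y × Tp p (X 0) (X 1) Y
  chain zero X p≤ g (a , b , c) G = X ⊕ 0 , cycle X (X ⊕ 0) g G a b c , ⊕-Good p≤ g , refl , refl , G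
  chain (suc zero) X p≤ g (a , b , c) G = X ⊕ 1 , cycle X (X ⊕ 1) g G a b c , ⊕-Good p≤ g , refl , refl , G
  chain (suc (suc p)) X p≤ g (a , b , c) G
    with chain p (X ⊕ (2 ℕ.+ p)) (ℕₚ.≤-trans (ℕₚ.m≤n+m p 2) p≤) (⊕-Good p≤ g) (a , b , c) G′
    where
    G′ : Level.G e (X ⊕ (2 ℕ.+ p)) (X ⊕ (2 ℕ.+ p) ⊕ p)
    G′ i = trans (ℕₚ.+-assoc (δ p i) _ _) (trans (cong (δ p i ℕ.+_) (G i)) (eq (δ p i) _ _ _ _))
      where eq : ∀ d x a c z → d ℕ.+ (x ℕ.+ a ℕ.+ c ℕ.+ z) ≡ d ℕ.+ x ℕ.+ a ℕ.+ c ℕ.+ z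
            eq = ℕR.solve-∀
  ... | Y , q , h , t = Y , cycle X (X ⊕ (2 ℕ.+ p)) g G a b c ⨾ q , h , t

  Reached : List ℤ → (ℕ → ℕ → (ℕ → ℕ) → Set) → ℕ → ℕ → Set
  Reached r T c z = Σ (ℕ → ℕ) λ X → (r ⟶[ 0 ] E X) × Good X × T c z X

  -- `Fix` refers to the old `z`. Replacing it by `suc z` raises `rhs` only at `suc v`, by `D-suc`
  -- and the index shift in `D⁺`, so the next passage adds 1 there and `chain` takes over.
  stepB : ∀ {r v c z} → Reached r TB c z → Valuation v (suc z) → Bounded c (suc z) → Reached r (Tp (suc v)) c (suc z)
  stepB {v = v} {c} {z} (X , p , g , refl , x₁ , fix) w (b₀ , b₁ , b₂) =
    Y , p ⨾ q , h , subst (λ k → Tp (suc v) c k Y) x₁ t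
    where
    G′ : G X (X ⊕ suc v)
    G′ i rewrite x₁ = trans (ℕₚ.+-assoc (δ (suc v) i) _ _) (trans (cong (δ (suc v) i ℕ.+_) (fix i)) (lem i))
      where
      eq : ∀ d x → d ℕ.+ x ≡ x ℕ.+ d
      eq = ℕR.solve-∀
      D⁺-suc : ∀ i → D⁺ (suc z) i ≡ D⁺ z i ℕ.+ δ (suc v) i
      D⁺-suc zero    = refl
      D⁺-suc (suc i) = D-suc z w refl i
      lem : ∀ i → δ (suc v) i ℕ.+ rhs c z X i ≡ rhs c (suc z) X i
      lem i rewrite D⁺-suc i = trans (eq (δ (suc v) i) (rhs c z X i)) (ℕₚ.+-assoc (X (2 ℕ.+ i) ℕ.+ add i ℕ.+ D c i) _ _)
    res = chain (suc v) X (Valuation-< L w b₂) g (b₀ , subst (pow2 e ≤_) (sym x₁) b₁ , subst (_< pow2 L) (sym x₁) b₂) G′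
    Y = proj₁ res
    q = proj₁ (proj₂ res)
    h = proj₁ (proj₂ (proj₂ res))
    t = proj₂ (proj₂ (proj₂ res))

  -- As for `stepB`, except that `D c` enters `rhs` unshifted, so the chain starts at `v` itself.
  stepA : ∀ {r v c z} → Reached r TA c z → Valuation v (suc c) → Bounded (suc c) z → Reached r (Tp v) (suc c) z
  stepA {v = v} {c} {z} (X , p , g , x₀ , refl , fix) w (b₀ , b₁ , b₂) =
    Y , p ⨾ q , h , subst (λ k → Tp v k z Y) x₀ t
    where
    G′ : G X (X ⊕ v)
    G′ i rewrite x₀ = trans (ℕₚ.+-assoc (δ v i) _ _) (trans (cong (δ v i ℕ.+_) (fix i)) (lem i))
      where
      eq : ∀ d x c z → d ℕ.+ (x ℕ.+ c ℕ.+ z) ≡ x ℕ.+ (c ℕ.+ d) ℕ.+ z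
      eq = ℕR.solve-∀
      lem : ∀ i → δ v i ℕ.+ rhs c z X i ≡ rhs (suc c) z X i
      lem i rewrite D-suc c w refl i = eq (δ v i) (X (2 ℕ.+ i) ℕ.+ add i) (D c i) (D⁺ z i)
    res = chain v X (ℕₚ.≤-trans (ℕₚ.<⇒≤ (Valuation-< (suc e) w b₀)) (ℕₚ.n≤1+n _)) g
      (subst (_< pow2 (suc e)) (sym x₀) b₀ , b₁ , b₂) G′
    Y = proj₁ res
    q = proj₁ (proj₂ res)
    h = proj₁ (proj₂ (proj₂ res))
    t = proj₂ (proj₂ (proj₂ res))

  -- Each `Fix` equation gives coordinate i from coordinate i + 2, and everything above L vanishes,
  -- so the values are forced from the top downwards.
  TB-unique : ∀ {c z X Y} → Good X → (∀ j → Y (suc L ℕ.+ j) ≡ 0) → TB c z X → TB c z Y → ∀ i → X i ≡ Y i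
  TB-unique {c} {z} {X} {Y} g y₀ (_ , _ , fixX) (_ , _ , fixY) i = go (suc L) i
      (ℕₚ.≤-trans (ℕₚ.m≤m+n (suc L) (suc L)) (ℕₚ.m≤n+m _ i))
    where
    beyond : ∀ (V : ℕ → ℕ) → (∀ j → V (suc L ℕ.+ j) ≡ 0) → ∀ i → L < i → V i ≡ 0
    beyond V v i l = trans (cong V (sym (ℕₚ.m+[n∸m]≡n l))) (v _)
    go : ∀ n i → L < i ℕ.+ (n ℕ.+ n) → X i ≡ Y i
    go zero i l = trans (beyond X (Good.vanish g) i l′) (sym (beyond Y y₀ i l′))
      where l′ = subst (L <_) (ℕₚ.+-identityʳ i) l
    go (suc n) i l = ℕₚ.+-cancelʳ-≡ (sub i) (X i) (Y i) (trans (fixX i)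
      (trans (cong (λ t → t ℕ.+ add i ℕ.+ D c i ℕ.+ D⁺ z i) (go n (2 ℕ.+ i) (subst (L <_) (eq i n) l))) (sym (fixY i))))
      where eq : ∀ i n → i ℕ.+ (suc n ℕ.+ suc n) ≡ 2 ℕ.+ i ℕ.+ (n ℕ.+ n)
            eq = ℕR.solve-∀

-- The joint ascent of X₀ and X₁.

module Sweep (e′ : ℕ) where
  e = suc e′
  open Level e
  open Path e

  W Z : ℕ
  W = pow2 e′
  Z = quad W

  -- X₀ = u and X₁ = Z + u + 1 are in step whenever u ≡ 2 mod 4; between two such
  -- u the order of the increments depends on the parity of v₂ (s + 1).
  block : ∀ {r} s → 2 ℕ.+ s ≤ W → Reached r TB (2 ℕ.+ quad s) (2 ℕ.+ (quad s ℕ.+ Z)) →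
          Reached r TB (6 ℕ.+ quad s) (6 ℕ.+ (quad s ℕ.+ Z))
  block {r} s s≤ R with Valuation-exists (suc s) s ℕₚ.≤-refl
  ... | v , w = by-parity (Tp-alternates v)
    where
    q = quad s
    qq = q ℕ.+ Z
    valZ : ∀ {u} j → Valuation u (j ℕ.+ quad (s ℕ.+ W)) → Valuation u (j ℕ.+ qq)
    valZ {u} j = subst (λ t → Valuation u (j ℕ.+ t)) (quad-+ s W)
    w′ : Valuation v (suc (s ℕ.+ W))
    w′ = Valuation-+pow2 e′ w s≤
    q≤ : 8 ℕ.+ q ≤ Z
    q≤ = subst (_≤ Z) (trans (quad-suc (suc s)) (cong (4 ℕ.+_) (quad-suc s)))
      (ℕₚ.+-mono-≤ (ℕₚ.+-mono-≤ s≤ s≤) (ℕₚ.+-mono-≤ s≤ s≤))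
    small : ∀ j k → j ℕ.+ k ≡ 7 → j ℕ.+ q < Z
    small j k p = ℕₚ.≤-trans (s≤s (ℕₚ.+-monoˡ-≤ q (subst (j ≤_) p (ℕₚ.m≤m+n j k)))) q≤
    bd : ∀ i i′ j j′ → i ℕ.+ i′ ≡ 7 → j ℕ.+ j′ ≡ 7 → Bounded (i ℕ.+ q) (j ℕ.+ qq)
    bd i i′ j j′ p p′ = small i i′ p
      , ℕₚ.≤-trans (ℕₚ.m≤m+n (W ℕ.+ W) (W ℕ.+ W)) (ℕₚ.≤-trans (ℕₚ.m≤n+m Z q) (ℕₚ.m≤n+m qq j))
      , subst (_< Z ℕ.+ Z) (ℕₚ.+-assoc j q Z) (ℕₚ.+-monoˡ-< Z (small j j′ p′))
    R₃ : Reached r TB (2 ℕ.+ q) (3 ℕ.+ qq)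
    R₃ = stepB R (valZ 3 (Val₃ (s ℕ.+ W))) (bd 2 5 3 4 refl refl)
    R₄ : Reached r (Tp (suc v)) (2 ℕ.+ q) (4 ℕ.+ qq)
    R₄ = stepB R₃ (valZ 4 (Val₄ (s ℕ.+ W) w′)) (bd 2 5 4 3 refl refl)
    by-parity : (Tp (suc v) ≡ TB × Tp v ≡ TA) ⊎ (Tp (suc v) ≡ TA × Tp v ≡ TB) → Reached r TB (6 ℕ.+ q) (6 ℕ.+ qq)
    -- For even `v` the multiples of 4 have even valuation, so handovers occur only at numbers ≡ 2
    -- mod 4.
    by-parity (inj₁ (p₁ , p₀)) = R₁₀
      where
      R₅ : Reached r TB (2 ℕ.+ q) (5 ℕ.+ qq)
      R₅ = stepB (subst (λ T → Reached r T (2 ℕ.+ q) (4 ℕ.+ qq)) p₁ R₄) (valZ 5 (Val₅ (s ℕ.+ W))) (bd 2 5 5 2 refl refl)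
      R₆ : Reached r TA (2 ℕ.+ q) (6 ℕ.+ qq)
      R₆ = stepB R₅ (valZ 6 (Val₆ (s ℕ.+ W))) (bd 2 5 6 1 refl refl)
      R₇ : Reached r TA (3 ℕ.+ q) (6 ℕ.+ qq)
      R₇ = stepA R₆ (Val₃ s) (bd 3 4 6 1 refl refl)
      R₈ : Reached r TA (4 ℕ.+ q) (6 ℕ.+ qq)
      R₈ = subst (λ T → Reached r T (4 ℕ.+ q) (6 ℕ.+ qq)) p₀ (stepA R₇ (Val₄ s w) (bd 4 3 6 1 refl refl))
      R₉ : Reached r TA (5 ℕ.+ q) (6 ℕ.+ qq)
      R₉ = stepA R₈ (Val₅ s) (bd 5 2 6 1 refl refl)
      R₁₀ : Reached r TB (6 ℕ.+ q) (6 ℕ.+ qq)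
      R₁₀ = stepA R₉ (Val₆ s) (bd 6 1 6 1 refl refl)
    -- For odd `v` the multiples of 4 hand over as well, from X₁ to X₀ and back.
    by-parity (inj₂ (p₁ , p₀)) = R₁₀
      where
      R₅ : Reached r TA (3 ℕ.+ q) (4 ℕ.+ qq)
      R₅ = stepA (subst (λ T → Reached r T (2 ℕ.+ q) (4 ℕ.+ qq)) p₁ R₄) (Val₃ s) (bd 3 4 4 3 refl refl)
      R₆ : Reached r TB (4 ℕ.+ q) (4 ℕ.+ qq)
      R₆ = subst (λ T → Reached r T (4 ℕ.+ q) (4 ℕ.+ qq)) p₀ (stepA R₅ (Val₄ s w) (bd 4 3 4 3 refl refl))
      R₇ : Reached r TB (4 ℕ.+ q) (5 ℕ.+ qq)
      R₇ = stepB R₆ (valZ 5 (Val₅ (s ℕ.+ W))) (bd 4 3 5 2 refl refl)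
      R₈ : Reached r TA (4 ℕ.+ q) (6 ℕ.+ qq)
      R₈ = stepB R₇ (valZ 6 (Val₆ (s ℕ.+ W))) (bd 4 3 6 1 refl refl)
      R₉ : Reached r TA (5 ℕ.+ q) (6 ℕ.+ qq)
      R₉ = stepA R₈ (Val₅ s) (bd 5 2 6 1 refl refl)
      R₁₀ : Reached r TB (6 ℕ.+ q) (6 ℕ.+ qq)
      R₁₀ = stepA R₉ (Val₆ s) (bd 6 1 6 1 refl refl)

  blocks : ∀ {r} s → suc s ≤ W → Reached r TB 2 (2 ℕ.+ Z) → Reached r TB (2 ℕ.+ quad s) (2 ℕ.+ (quad s ℕ.+ Z))
  blocks zero    s≤ R = R
  blocks {r} (suc s) s≤ R = subst (λ t → Reached r TB (2 ℕ.+ t) (2 ℕ.+ (t ℕ.+ Z))) (sym (quad-suc s))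
    (block s s≤ (blocks s (ℕₚ.<⇒≤ s≤) R))

  -- At the start X₀ = 0 and X₁ = Z. Since v₂(Z) = 2 + e′ is even, Z causes no handover, and five
  -- steps reach the first aligned pair. The blocks lead to X₀ = Z - 2, X₁ = 2Z - 1, and one more
  -- increment gives X₁ = 2^L, where `Bounded` ends.
  sweep : ∀ {r} → Tp e′ ≡ TA → Reached r TB 0 (mers (suc e)) → Reached r TB (mers e ℕ.+ mers e) (mers L)
  sweep {r} even-e′ R =
    subst₂ (Reached r TB) (eq₁ m) (trans (cong (λ t → 3 ℕ.+ (quad m ℕ.+ quad t)) (sym (suc-mers e′))) (eq₂ m))
      (stepB (blocks m (ℕₚ.≤-reflexive (suc-mers e′)) R₂)
        (subst (λ t → Valuation 0 (3 ℕ.+ t)) (quad-+ m W) (Val₃ (m ℕ.+ W)))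
        (bound , ℕₚ.≤-trans (ℕₚ.m≤m+n (W ℕ.+ W) (W ℕ.+ W)) (ℕₚ.≤-trans (ℕₚ.m≤n+m Z (quad m)) (ℕₚ.m≤n+m _ 3))
         , subst (_< Z ℕ.+ Z) (ℕₚ.+-assoc 3 (quad m) Z) (ℕₚ.+-monoˡ-< Z bound₃)))
    where
    m = mers e′
    eq₁ : ∀ m → 2 ℕ.+ ((m ℕ.+ m) ℕ.+ (m ℕ.+ m)) ≡ suc (m ℕ.+ m) ℕ.+ suc (m ℕ.+ m)
    eq₁ = ℕR.solve-∀
    eq₂ : ∀ m → 3 ℕ.+ (((m ℕ.+ m) ℕ.+ (m ℕ.+ m)) ℕ.+ ((suc m ℕ.+ suc m) ℕ.+ (suc m ℕ.+ suc m)))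
          ≡ suc (suc (suc (m ℕ.+ m) ℕ.+ suc (m ℕ.+ m)) ℕ.+ suc (suc (m ℕ.+ m) ℕ.+ suc (m ℕ.+ m)))
    eq₂ = ℕR.solve-∀
    bound₃ : 3 ℕ.+ quad m < Z
    bound₃ = ℕₚ.≤-reflexive (trans (sym (quad-suc m)) (cong quad (suc-mers e′)))
    bound : 2 ℕ.+ quad m < Z
    bound = ℕₚ.<-trans (ℕₚ.n<1+n _) bound₃
    4≤Z : 4 ≤ Z
    4≤Z = ℕₚ.≤-trans (ℕₚ.m≤m+n 4 (quad m)) bound₃
    bd : ∀ i i′ j j′ → i ℕ.+ i′ ≡ 3 → j ℕ.+ j′ ≡ 3 → Bounded i (j ℕ.+ Z)
    bd i i′ j j′ p p′ = ℕₚ.≤-trans (s≤s (subst (i ≤_) p (ℕₚ.m≤m+n i i′))) 4≤Z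
      , ℕₚ.≤-trans (ℕₚ.m≤m+n (W ℕ.+ W) (W ℕ.+ W)) (ℕₚ.m≤n+m Z j)
      , ℕₚ.+-monoˡ-< Z (ℕₚ.≤-trans (s≤s (subst (j ≤_) p′ (ℕₚ.m≤m+n j j′))) 4≤Z)
    Z≡ : suc (mers (suc e)) ≡ Z
    Z≡ = suc-mers (suc e)
    odd-Tp : Tp (suc e′) ≡ TB
    odd-Tp with Tp-alternates e′
    ... | inj₁ (p , _) = p
    ... | inj₂ (p , q) = trans p (trans (sym even-e′) q)
    S₀ : Reached r TB 0 Z
    S₀ = subst (λ T → Reached r T 0 Z) odd-Tp (subst (Reached r (Tp (suc e′)) 0) Z≡
      (stepB R (subst (Valuation (2 ℕ.+ e′)) (sym Z≡) (Valuation-pow2 (2 ℕ.+ e′)))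
        (subst (Bounded 0) (sym Z≡) (bd 0 3 0 3 refl refl))))
    S₁ : Reached r TB 0 (1 ℕ.+ Z)
    S₁ = stepB S₀ (Val₁ W) (bd 0 3 1 2 refl refl)
    S₂ : Reached r TA 0 (2 ℕ.+ Z)
    S₂ = stepB S₁ (Val₂ W) (bd 0 3 2 1 refl refl)
    S₃ : Reached r TA 1 (2 ℕ.+ Z)
    S₃ = stepA S₂ (odd-part 0) (bd 1 2 2 1 refl refl)
    R₂ : Reached r TB 2 (2 ℕ.+ Z)
    R₂ = stepA S₃ (double (odd-part 0)) (bd 2 1 2 1 refl refl)

-- Explicit coordinates at the start, at the peak and after the Overflow.

pw-vanish : ∀ l j → pw l (l ℕ.+ j) ≡ 0
pw-vanish zero    j = refl
pw-vanish (suc l) j = pw-vanish l j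

-- The `Fix` equation of the start coordinates; away from the top it reads 4q = q + q + 2q.
pw-fix : ∀ l i → pw (suc l) i ≡ pw (suc l) (2 ℕ.+ i) ℕ.+ κ (suc l) i ℕ.+ pw l i
pw-fix zero          zero    = refl
pw-fix (suc zero)    zero    = refl
pw-fix (suc (suc l)) zero    = refl
pw-fix zero          (suc i) = refl
pw-fix (suc zero)    (suc i) = pw-fix zero i
pw-fix (suc (suc l)) (suc i) = pw-fix (suc l) i

-- peakRow and freshRow are the coordinates of the all-even states before and
-- after the Overflow; their recursions are those imposed by G.
peakVal : ℕ → ℕ
peakVal zero          = 2
peakVal (suc zero)    = 3
peakVal (suc (suc j)) = peakVal j ℕ.+ pow2 j ℕ.+ pow2 j ℕ.+ pow2 (2 ℕ.+ j)

peakRow : ℕ → ℕ → ℕ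
peakRow zero    _       = 0
peakRow (suc l) zero    = peakVal l
peakRow (suc l) (suc i) = peakRow l i

peakRow-vanish : ∀ l j → peakRow l (l ℕ.+ j) ≡ 0
peakRow-vanish zero    j = refl
peakRow-vanish (suc l) j = peakRow-vanish l j

peakRow-fix : ∀ l i → peakRow l i ≡ peakRow l (2 ℕ.+ i) ℕ.+ κ l i ℕ.+ pw l (2 ℕ.+ i) ℕ.+ pw l i
peakRow-fix zero                i       = refl
peakRow-fix (suc zero)          zero    = refl
peakRow-fix (suc (suc zero))    zero    = refl
peakRow-fix (suc (suc (suc l))) zero    = refl
peakRow-fix (suc zero)          (suc i) = peakRow-fix zero i
peakRow-fix (suc (suc zero))    (suc i) = peakRow-fix (suc zero) i
peakRow-fix (suc (suc (suc l))) (suc i) = peakRow-fix (suc (suc l)) i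

freshVal : ℕ → ℕ
freshVal zero                = 1
freshVal (suc zero)          = 2
freshVal (suc (suc zero))    = 3
freshVal (suc (suc (suc j))) = freshVal (suc j) ℕ.+ pow2 (suc j) ℕ.+ pow2 (2 ℕ.+ j)

freshRow : ℕ → ℕ → ℕ
freshRow zero    _       = 0
freshRow (suc l) zero    = freshVal l
freshRow (suc l) (suc i) = freshRow l i

freshRow-vanish : ∀ l j → freshRow l (l ℕ.+ j) ≡ 0
freshRow-vanish zero    j = refl
freshRow-vanish (suc l) j = freshRow-vanish l j

-- The `δ` is the pending increment, at coordinate l + 1, with which the run after the Overflow
-- begins.
freshRow-fix : ∀ l i → δ l i ℕ.+ freshRow (3 ℕ.+ l) i
  ≡ freshRow (3 ℕ.+ l) (2 ℕ.+ i) ℕ.+ κ (3 ℕ.+ l) i ℕ.+ pw (3 ℕ.+ l) (suc i)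
freshRow-fix zero    zero                = refl
freshRow-fix (suc l) zero                = refl
freshRow-fix (suc l) (suc i)             = freshRow-fix l i
freshRow-fix zero    (suc zero)          = refl
freshRow-fix zero    (suc (suc zero))    = refl
freshRow-fix zero    (suc (suc (suc i))) = refl

-- Doubling that exposes two successors, so that functions recursing by two, such as `Tp` and
-- `peakVal`, compute along `k`.
dbl : ℕ → ℕ
dbl zero    = 0
dbl (suc k) = 2 ℕ.+ dbl k

dbl-+ : ∀ k → dbl k ≡ k ℕ.+ k
dbl-+ zero    = refl
dbl-+ (suc k) = cong suc (trans (cong suc (dbl-+ k)) (sym (ℕₚ.+-suc k k)))

-- The recursion by two preserves the deviation from a power of two, which is 1 at odd arguments and
-- 0 at even ones.
peakVal-odd : ∀ k → suc (peakVal (1 ℕ.+ dbl k)) ≡ pow2 (2 ℕ.+ dbl k)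
peakVal-odd zero    = refl
peakVal-odd (suc k) = trans (eq (peakVal (1 ℕ.+ dbl k)) p p (pow2 (3 ℕ.+ dbl k)))
  (trans (cong (λ t → t ℕ.+ p ℕ.+ p ℕ.+ pow2 (3 ℕ.+ dbl k)) (peakVal-odd k)) (eq′ p))
  where
  p = pow2 (1 ℕ.+ dbl k)
  eq : ∀ f a b c → suc (f ℕ.+ a ℕ.+ b ℕ.+ c) ≡ suc f ℕ.+ a ℕ.+ b ℕ.+ c
  eq = ℕR.solve-∀
  eq′ : ∀ p → (p ℕ.+ p) ℕ.+ p ℕ.+ p ℕ.+ ((p ℕ.+ p) ℕ.+ (p ℕ.+ p))
    ≡ ((p ℕ.+ p) ℕ.+ (p ℕ.+ p)) ℕ.+ ((p ℕ.+ p) ℕ.+ (p ℕ.+ p))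
  eq′ = ℕR.solve-∀

peakVal-even : ∀ k → peakVal (2 ℕ.+ dbl k) ≡ pow2 (3 ℕ.+ dbl k)
peakVal-even zero    = refl
peakVal-even (suc k) = trans (cong (λ t → t ℕ.+ p ℕ.+ p ℕ.+ pow2 (4 ℕ.+ dbl k)) (peakVal-even k)) (eq p)
  where
  p = pow2 (2 ℕ.+ dbl k)
  eq : ∀ p → (p ℕ.+ p) ℕ.+ p ℕ.+ p ℕ.+ ((p ℕ.+ p) ℕ.+ (p ℕ.+ p)) ≡ ((p ℕ.+ p) ℕ.+ (p ℕ.+ p)) ℕ.+ ((p ℕ.+ p) ℕ.+ (p ℕ.+ p))
  eq = ℕR.solve-∀

freshVal-even : ∀ k → suc (freshVal (2 ℕ.+ dbl k)) ≡ pow2 (2 ℕ.+ dbl k)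
freshVal-even zero    = refl
freshVal-even (suc k) = cong (λ t → t ℕ.+ pow2 (2 ℕ.+ dbl k) ℕ.+ pow2 (3 ℕ.+ dbl k)) (freshVal-even k)

freshVal-odd : ∀ k → freshVal (1 ℕ.+ dbl k) ≡ pow2 (1 ℕ.+ dbl k)
freshVal-odd zero    = refl
freshVal-odd (suc k) = cong (λ t → t ℕ.+ pow2 (1 ℕ.+ dbl k) ℕ.+ pow2 (2 ℕ.+ dbl k)) (freshVal-odd k)

freshVal-peakVal : ∀ j → freshVal (3 ℕ.+ j) ℕ.+ freshVal (3 ℕ.+ j)
  ≡ pow2 (2 ℕ.+ j) ℕ.+ pow2 (2 ℕ.+ j) ℕ.+ (peakVal j ℕ.+ peakVal j) ℕ.+ pow2 (2 ℕ.+ j)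
freshVal-peakVal zero          = refl
freshVal-peakVal (suc zero)    = refl
freshVal-peakVal (suc (suc j)) = trans (eq₁ (freshVal (3 ℕ.+ j)) (pow2 (3 ℕ.+ j)) (pow2 (4 ℕ.+ j)))
  (trans (cong (λ t → t ℕ.+ (pow2 (3 ℕ.+ j) ℕ.+ pow2 (3 ℕ.+ j)) ℕ.+ (pow2 (4 ℕ.+ j) ℕ.+ pow2 (4 ℕ.+ j)))
      (freshVal-peakVal j))
    (eq₂ (peakVal j) (pow2 j)))
  where
  eq₁ : ∀ o a b → (o ℕ.+ a ℕ.+ b) ℕ.+ (o ℕ.+ a ℕ.+ b) ≡ (o ℕ.+ o) ℕ.+ (a ℕ.+ a) ℕ.+ (b ℕ.+ b)
  eq₁ = ℕR.solve-∀
  eq₂ : ∀ f p → let p₁ = p ℕ.+ p ; p₂ = p₁ ℕ.+ p₁ ; p₃ = p₂ ℕ.+ p₂ ; p₄ = p₃ ℕ.+ p₃ ; f′ = f ℕ.+ p ℕ.+ p ℕ.+ p₂ in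
    p₂ ℕ.+ p₂ ℕ.+ (f ℕ.+ f) ℕ.+ p₂ ℕ.+ (p₃ ℕ.+ p₃) ℕ.+ (p₄ ℕ.+ p₄) ≡ p₄ ℕ.+ p₄ ℕ.+ (f′ ℕ.+ f′) ℕ.+ p₄
  eq₂ = ℕR.solve-∀

-- Entries below the top survive the Overflow: twice the new coordinate minus its shift must equal
-- the old entry at a full counter, where `D` is `pw (suc l)`. The subtraction is moved across.
freshRow-peakRow : ∀ l i → i < l → freshRow (2 ℕ.+ l) i ℕ.+ freshRow (2 ℕ.+ l) i
  ≡ halfPw (2 ℕ.+ l) i ℕ.+ halfPw (2 ℕ.+ l) i ℕ.+ (peakRow l (suc i) ℕ.+ peakRow l (suc i)) ℕ.+ pw (suc l) i
freshRow-peakRow (suc zero)          zero    _       = refl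
freshRow-peakRow (suc (suc zero))    zero    _       = refl
freshRow-peakRow (suc (suc (suc l))) zero    _       = freshVal-peakVal (suc l)
freshRow-peakRow (suc l)             (suc i) (s≤s p) = freshRow-peakRow l i p

-- At a full counter the counts are powers of two, odd only at the top entry.
overflow-mers : ∀ l x (b : ℕ → ℤ) → overflowCond (twice x ∷ applyUpTo (up b (mers (suc l))) (suc l)) ≡ true
overflow-mers zero x b rewrite isOdd-even x = isOdd-odd (b 0)
overflow-mers (suc l) x b rewrite isOdd-even x =
  trans (cong₂ (λ t n → overflowCond (t ∷ applyUpTo (up (b ∘ suc) n) (suc l))) head-eq (half-odd m))
    (overflow-mers l (b 0 ℤ.+ + pow2 l) (b ∘ suc))
  where
  m = mers (suc l)
  eq : ∀ b p → b ℤ.+ b ℤ.+ (p ℤ.+ p) ≡ (b ℤ.+ p) ℤ.+ (b ℤ.+ p)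
  eq = ℤR.solve-∀
  head-eq : b 0 ℤ.+ b 0 ℤ.+ + suc ⌊ m ℕ.+ m /2⌋ ≡ twice (b 0 ℤ.+ + pow2 l)
  head-eq = trans (cong (λ t → b 0 ℤ.+ b 0 ℤ.+ + t) (trans (cong suc (half-even m)) (suc-mers (suc l))))
    (eq (b 0) (+ pow2 l))

overflowStep-applyUpTo : ∀ n x (f g : ℕ → ℤ) → (∀ i → i < n → g i ≡ f i) → g n ≡ f n ℤ.+ 1ℤ → g (suc n) ≡ 0ℤ →
  overflowStep (x ∷ applyUpTo f (suc n)) ≡ x ∷ applyUpTo g (2 ℕ.+ n)
overflowStep-applyUpTo zero    x f g p q r = cong₂ (λ a b → x ∷ a ∷ b ∷ []) (sym q) (sym r)
overflowStep-applyUpTo (suc n) x f g p q r = cong (x ∷_) (trans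
  (overflowStep-applyUpTo n (f 0) (f ∘ suc) (g ∘ suc) (λ i l → p (suc i) (s≤s l)) q r)
  (cong (_∷ applyUpTo (g ∘ suc) (2 ℕ.+ n)) (sym (p 0 (s≤s z≤n)))))

startCoords : ℕ → ℕ → ℕ
startCoords l zero    = 0
startCoords l (suc i) = pw l i

module States (e : ℕ) where
  open Level e
  open Path e

  s : ℕ → ℕ
  s = startCoords L

  -- The start state looks as if X₁ had just been incremented to 2^(L-1). Hence `sweep` can begin
  -- there, and `TB-unique` can recognise it on return.
  s-TB : TB 0 (mers (suc e)) s
  s-TB = refl , sym (suc-mers (suc e)) , fix
    where
    fix : Fix 0 (mers (suc e)) s
    fix zero    = eq (pow2 e)
      where eq : ∀ p → p ≡ p ℕ.+ 0 ℕ.+ 0 ℕ.+ 0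
            eq = ℕR.solve-∀
    fix (suc i) rewrite D-zero i | D-mers (suc e) i =
      trans (ℕₚ.+-identityʳ _) (trans (pw-fix (suc e) i) (cong (ℕ._+ pw (suc e) i) (sym (ℕₚ.+-identityʳ _))))

  s-Good : Good s
  s-Good = record { vanish = pw-vanish L ; top = ℕₚ.≤-reflexive (sym (pw-top e)) }
    where pw-top : ∀ n → pw (2 ℕ.+ n) n ≡ 2
          pw-top zero    = refl
          pw-top (suc n) = pw-top n

  f : ℕ → ℕ
  f zero    = mers e ℕ.+ mers e
  f (suc i) = peakRow L i

  f-TB : peakVal (suc e) ≡ pow2 L → suc (peakVal e) ≡ pow2 (suc e) → TB (mers e ℕ.+ mers e) (mers L) f
  f-TB p q = refl , trans p (sym (suc-mers L)) , fix
    where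
    m = mers e
    fix : Fix (m ℕ.+ m) (mers L) f
    fix zero rewrite half-odd m = trans (cong (m ℕ.+ m ℕ.+_) (sym (suc-mers e))) (trans (eq m)
      (cong (λ t → t ℕ.+ 0 ℕ.+ m ℕ.+ 0)
        (ℕₚ.suc-injective (sym (trans q (sym (suc-mers (suc e))))))))
      where eq : ∀ m → m ℕ.+ m ℕ.+ suc m ≡ suc (m ℕ.+ m) ℕ.+ 0 ℕ.+ m ℕ.+ 0
            eq = ℕR.solve-∀
    fix (suc i) rewrite half-even m | D-mers e i | D-mers L i = trans (ℕₚ.+-identityʳ _) (peakRow-fix L i)

  -- Coordinate 1 is two below `s 1`, because X₁ is incremented twice between the Overflow and the
  -- next start state.
  o : ℕ → ℕ
  o zero          = 0
  o (suc zero)    = mers e ℕ.+ mers e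
  o (suc (suc i)) = freshRow L (suc i)

-- The Overflow and the return to a start state.

module Pass (k : ℕ) where
  e′ = dbl k
  e = suc e′
  open Level e
  open Path e
  open States e
  module N = Level (2 ℕ.+ e)
  module NP = Path (2 ℕ.+ e)
  module NS = States (2 ℕ.+ e)

  -- Here n = 1 and X₁ = 2^L. In the ascent the head 2^(L+1) - 2 has come down to 0 when the counter
  -- reaches its maximum 2^(L+1) - 1, so Overflow applies one step before the head would be -1.
  overflow-pass : ∀ X → Good X → TB (mers e ℕ.+ mers e) (mers L) X → E X ⟶[ 1 ] N.E NS.o
  overflow-pass X g tb@(x₀ , x₁ , _) = zero-step X g ⨾ (first-descent X 1 sum
      ⨾ (subst₂ (λ a b → a ∷ b ⟶[ 0 ] target) (sym head-eq) (applyUpTo-cong (λ i → eqb (h i) (+ D 1 i)) (3 ℕ.+ e))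
          (subst (λ t → predℤ ((M ℕ.+ M) ℕ.+ 1) ∷ applyUpTo (up b 1) (3 ℕ.+ e) ⟶[ 0 ] 0ℤ ∷ applyUpTo (up b t) (3 ℕ.+ e))
            (ℕₚ.+-comm (M ℕ.+ M) 1)
            (up-run (3 ℕ.+ e) (M ℕ.+ M) 1 1 (+ M ℤ.- 1ℤ) b bound par))
        ⨾ step {ρ = Overflow} ovf done))
    where
    M = mers L
    X≡f : ∀ i → X i ≡ f i
    X≡f = TB-unique g (peakRow-vanish L) tb (f-TB (peakVal-even k) (peakVal-odd k))
    h b : ℕ → ℤ
    h i = + X (2 ℕ.+ i)
    b i = h i ℤ.- + D 1 i
    target : List ℤ
    target = 0ℤ ∷ applyUpTo (up b (mers (3 ℕ.+ e))) (3 ℕ.+ e)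
    sum : X 0 ℕ.+ 1 ≡ mers (suc e)
    sum = trans (cong (ℕ._+ 1) x₀) (ℕₚ.+-comm _ 1)
    eqb : ∀ h d → (h ℤ.- d) ℤ.+ (h ℤ.- d) ℤ.+ d ≡ h ℤ.+ h ℤ.- d
    eqb = ℤR.solve-∀
    head-eq : + X 1 ℤ.+ + X 1 ℤ.- + 2 ≡ predℤ ((M ℕ.+ M) ℕ.+ 1)
    head-eq = trans (cong (λ t → + t ℤ.+ + t ℤ.- + 2) x₁)
       (trans (eq (+ M)) (cong predℤ (ℕₚ.+-comm 1 (M ℕ.+ M))))
      where eq : ∀ m → (1ℤ ℤ.+ m) ℤ.+ (1ℤ ℤ.+ m) ℤ.- (1ℤ ℤ.+ 1ℤ) ≡ m ℤ.+ m
            eq = ℤR.solve-∀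
    bound : (M ℕ.+ M) ℕ.+ 1 < pow2 (3 ℕ.+ e)
    bound = ℕₚ.≤-reflexive (trans (cong suc (ℕₚ.+-comm (M ℕ.+ M) 1)) (suc-mers (3 ℕ.+ e)))
    par : predℤ ((M ℕ.+ M) ℕ.+ 1) ≡ (+ M ℤ.- 1ℤ) ℤ.+ (+ M ℤ.- 1ℤ) ℤ.+ + 2
    par = trans (cong predℤ (ℕₚ.+-comm (M ℕ.+ M) 1)) (eq (+ M))
      where eq : ∀ m → m ℤ.+ m ≡ (m ℤ.- 1ℤ) ℤ.+ (m ℤ.- 1ℤ) ℤ.+ (1ℤ ℤ.+ 1ℤ)
            eq = ℤR.solve-∀
    new : ℕ → ℤ
    new i = twice (+ NS.o (suc i) ℤ.- + halfPw (4 ℕ.+ e) i)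
    last : ∀ l → freshRow (2 ℕ.+ l) l ≡ 2 × halfPw (2 ℕ.+ l) l ≡ 1 × pw (suc l) l ≡ 1
      × freshRow (2 ℕ.+ l) (suc l) ≡ 1 × halfPw (2 ℕ.+ l) (suc l) ≡ 1
    last zero    = refl , refl , refl , refl , refl
    last (suc l) = last l
    inner : ∀ i → i < L → new i ≡ up b (mers (3 ℕ.+ e)) i
    -- `D 1` is nonzero only at index 0, so only this entry feels the rebasing from descent to
    -- ascent.
    inner zero _ = eq (mers (suc e)) (X 2) _ _
        (trans (X≡f 2) (ℕₚ.suc-injective (trans (peakVal-odd k) (sym (suc-mers (suc e))))))
        (sym (suc-mers L)) (cong suc (half-even M))
      where
      eqz : ∀ a → let m = 1ℤ ℤ.+ (a ℤ.+ a) in (m ℤ.+ m ℤ.- (1ℤ ℤ.+ m)) ℤ.+ (m ℤ.+ m ℤ.- (1ℤ ℤ.+ m))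
        ≡ (a ℤ.- 1ℤ) ℤ.+ (a ℤ.- 1ℤ) ℤ.+ (1ℤ ℤ.+ m)
      eqz = ℤR.solve-∀
      eq : ∀ a x p d → x ≡ a → p ≡ suc (suc (a ℕ.+ a)) → d ≡ suc (suc (a ℕ.+ a)) →
        twice (+ (suc (a ℕ.+ a) ℕ.+ suc (a ℕ.+ a)) ℤ.- + p) ≡ twice (+ x ℤ.- 1ℤ) ℤ.+ + d
      eq a _ _ _ refl refl refl = eqz (+ a)
    inner (suc i) l = lem (freshRow (4 ℕ.+ e) (suc i)) H (X (3 ℕ.+ i)) _ _
      (trans (freshRow-peakRow L (suc i) l)
        (cong (λ t → H ℕ.+ H ℕ.+ (t ℕ.+ t) ℕ.+ pw (3 ℕ.+ e) (suc i)) (sym (X≡f (3 ℕ.+ i)))))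
      (D-zero i) (D-mers (3 ℕ.+ e) (suc i))
      where
      H = halfPw (4 ℕ.+ e) (suc i)
      lem : ∀ o h x d p {d₀} → o ℕ.+ o ≡ h ℕ.+ h ℕ.+ (x ℕ.+ x) ℕ.+ p → d₀ ≡ 0 → d ≡ p →
        twice (+ o ℤ.- + h) ≡ twice (+ x ℤ.- + d₀) ℤ.+ + d
      lem o h x d .d q refl refl = trans (e₁ (+ o) (+ h))
        (trans (cong (λ t → + t ℤ.- (+ h ℤ.+ + h)) q) (e₂ (+ h) (+ x) (+ d)))
        where e₁ : ∀ o h → (o ℤ.- h) ℤ.+ (o ℤ.- h) ≡ o ℤ.+ o ℤ.- (h ℤ.+ h)
              e₁ = ℤR.solve-∀
              e₂ : ∀ h x d → h ℤ.+ h ℤ.+ (x ℤ.+ x) ℤ.+ d ℤ.- (h ℤ.+ h) ≡ (x ℤ.- 0ℤ) ℤ.+ (x ℤ.- 0ℤ) ℤ.+ d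
              e₂ = ℤR.solve-∀
    edge : new L ≡ up b (mers (3 ℕ.+ e)) L ℤ.+ 1ℤ
    edge with last L
    ... | p , q , r , _ = lem _ _ _ _ _ p q
          (trans (cong (X ∘ suc) (ℕₚ.+-comm 1 L)) (Good.vanish g 1))
          (D-zero (1 ℕ.+ e)) (trans (D-mers (3 ℕ.+ e) L) r)
      where
      lem : ∀ o h x d p → o ≡ 2 → h ≡ 1 → x ≡ 0 → d ≡ 0 → p ≡ 1 → twice (+ o ℤ.- + h) ≡ twice (+ x ℤ.- + d) ℤ.+ + p ℤ.+ 1ℤ
      lem _ _ _ _ _ refl refl refl refl refl = refl
    outer : new (suc L) ≡ 0ℤ
    outer with last L
    ... | _ , _ , _ , p , q = lem _ _ p q
      where
      lem : ∀ o h → o ≡ 1 → h ≡ 1 → twice (+ o ℤ.- + h) ≡ 0ℤ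
      lem _ _ refl refl = refl
    ovf : stepRev target ≡ just (Overflow , N.E NS.o)
    ovf rewrite overflow-mers (2 ℕ.+ e) 0ℤ b =
      cong (λ t → just (Overflow , t)) (overflowStep-applyUpTo L 0ℤ (up b (mers (3 ℕ.+ e))) new inner edge outer)

  o-Good : N.Good NS.o
  o-Good = record { vanish = λ j → freshRow-vanish (4 ℕ.+ e) j ; top = ℕₚ.≤-reflexive (sym (os-top (2 ℕ.+ e))) }
    where os-top : ∀ n → freshRow (2 ℕ.+ n) n ≡ 2
          os-top zero    = refl
          os-top (suc n) = os-top n

  o-pending : N.G NS.o (NS.o NP.⊕ (2 ℕ.+ e))
  o-pending zero = trans (sym (freshVal-odd (suc k))) (eq (freshVal (2 ℕ.+ e)))
    where eq : ∀ p → p ≡ p ℕ.+ 0 ℕ.+ 0 ℕ.+ 0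
          eq = ℕR.solve-∀
  -- Coordinate 1 and the count `D (m + m) 0` are each one below the values in `freshRow-fix`, so
  -- the two deficits cancel.
  o-pending (suc zero) rewrite half-odd (mers (2 ℕ.+ e)) =
    ℕₚ.suc-injective (trans (eq m) (trans (ℕₚ.suc-injective
      (trans (cong suc (trans (ℕₚ.suc-injective (trans (suc-mers (3 ℕ.+ e)) (sym (freshVal-even (suc k)))))
        (freshRow-fix (2 ℕ.+ e′) 0)))
        (cong (λ t → suc (a ℕ.+ κ′ ℕ.+ t)) (sym (suc-mers (2 ℕ.+ e)))))) (eq′ a κ′ m)))
    where
    m = mers (2 ℕ.+ e)
    a = freshRow (4 ℕ.+ e) 2
    κ′ = κ (4 ℕ.+ e) 0
    eq : ∀ m → suc (m ℕ.+ m ℕ.+ 0) ≡ suc (m ℕ.+ m)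
    eq = ℕR.solve-∀
    eq′ : ∀ a k m → a ℕ.+ k ℕ.+ suc m ≡ suc (a ℕ.+ k ℕ.+ 0 ℕ.+ m)
    eq′ = ℕR.solve-∀
  o-pending (suc (suc i)) rewrite half-even (mers (2 ℕ.+ e)) | D-zero i | D-mers (2 ℕ.+ e) i =
    trans (ℕₚ.+-identityʳ _) (trans (freshRow-fix (2 ℕ.+ e′) (suc i))
      (cong (ℕ._+ pw (2 ℕ.+ e) i) (sym (ℕₚ.+-identityʳ _))))

  Tp-dbl : ∀ j → Tp (dbl j) ≡ TA
  Tp-dbl zero    = refl
  Tp-dbl (suc j) = Tp-dbl j

  NTp-dbl : ∀ j → NP.Tp (suc (dbl j)) ≡ NP.TB
  NTp-dbl zero    = refl
  NTp-dbl (suc j) = NTp-dbl j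

  E-cong : ∀ e {X Y} → (∀ i → X i ≡ Y i) → Level.E e X ≡ Level.E e Y
  E-cong e p = cong₂ _∷_ (cong (λ t → twice (+ t)) (p 0))
    (applyUpTo-cong (λ i → cong (λ t → twice (+ t ℤ.- + halfPw (2 ℕ.+ e) i)) (p (suc i))) (2 ℕ.+ e))

  -- After the sweep and the Overflow, the chain from the odd coordinate 2 + e ends by incrementing
  -- X₁. `TB-unique` then identifies the final state without following all its coordinates.
  pass : E s ⟶[ 1 ] N.E NS.s
  pass = to-overflow ⨾ (overflow-pass X X-Good X-TB ⨾ subst (N.E NS.o ⟶[ 0 ]_) (E-cong (2 ℕ.+ e) Y≡s) to-s)
    where
    swept : Reached (E s) TB (mers e ℕ.+ mers e) (mers L)
    swept = Sweep.sweep e′ (Tp-dbl k) (s , done , s-Good , s-TB)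
    X = proj₁ swept
    to-overflow = proj₁ (proj₂ swept)
    X-Good = proj₁ (proj₂ (proj₂ swept))
    X-TB = proj₂ (proj₂ (proj₂ swept))
    m = mers (2 ℕ.+ e)
    bd : ∀ j → suc j ≤ 2 → NP.Bounded 0 (j ℕ.+ (m ℕ.+ m))
    bd j l = ℕₚ.≤-trans (s≤s z≤n) (ℕₚ.≤-reflexive (suc-mers (3 ℕ.+ e)))
      , ℕₚ.≤-trans (ℕₚ.≤-reflexive (sym (suc-mers (2 ℕ.+ e))))
        (ℕₚ.≤-trans (ℕₚ.+-monoˡ-≤ m {x = 1} {y = m} (s≤s z≤n)) (ℕₚ.m≤n+m (m ℕ.+ m) j))
      , ℕₚ.≤-trans (ℕₚ.+-monoˡ-≤ (m ℕ.+ m) {x = suc j} l)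
        (ℕₚ.≤-trans (ℕₚ.≤-reflexive (suc-mers (3 ℕ.+ e))) (ℕₚ.m≤m+n (pow2 (3 ℕ.+ e)) _))
    first : NP.Reached (N.E NS.o) NP.TB 0 (m ℕ.+ m)
    first = subst (λ T → NP.Reached (N.E NS.o) T 0 (m ℕ.+ m)) (NTp-dbl k)
      (NP.chain (2 ℕ.+ e) NS.o (ℕₚ.m≤n+m (2 ℕ.+ e) 2) o-Good (bd 0 (s≤s z≤n)) o-pending)
    -- X₁ = suc (m + m) is odd, so its valuation is 0 and coordinate 1 is incremented a second time.
    second : NP.Reached (N.E NS.o) NP.TB 0 (mers (3 ℕ.+ e))
    second = NP.stepB first (odd-part m) (bd 1 ℕₚ.≤-refl)
    Y = proj₁ second
    to-s = proj₁ (proj₂ second)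
    Y≡s : ∀ i → Y i ≡ NS.s i
    Y≡s = NP.TB-unique (proj₁ (proj₂ (proj₂ second))) (pw-vanish (4 ℕ.+ e)) (proj₂ (proj₂ (proj₂ second))) NS.s-TB

-- Transfer to `run` and `Pⁿ`.

stepR-reverse : ∀ {ρ} r s → stepRev r ≡ just (ρ , s) → stepR (reverse r) ≡ just (ρ , reverse s)
stepR-reverse r s p rewrite Lₚ.reverse-involutive r | p = refl

run-suc : ∀ {j ρ ρs S T U} → stepR S ≡ just (ρ , T) → run j T ≡ just (ρs , U) →
  run (suc j) S ≡ just (ρ ∷ ρs , U)
run-suc p q rewrite p | q = refl

⟶⇒run : ∀ {r n t} → r ⟶[ n ] t →
  Σ ℕ λ j → Σ (List Rule) λ ρs → (run j (reverse r) ≡ just (ρs , reverse t)) × (countOverflow ρs ≡ n)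
⟶⇒run done = 0 , [] , refl , refl
⟶⇒run (step {r} {ρ} {s} p q) with ⟶⇒run q
... | j , ρs , runs , count = suc j , ρ ∷ ρs , run-suc {j} {S = reverse r} (stepR-reverse r s p) runs ,
  cong ((if isOverflow ρ then 1 else 0) ℕ.+_) count

run-++ : ∀ i {j S T U ρs σs} → run i S ≡ just (ρs , T) → run j T ≡ just (σs , U) →
  ∃ λ τs → run (i ℕ.+ j) S ≡ just (τs , U)
run-++ zero {σs = σs} refl q = σs , q
run-++ (suc i) {j} {S} p q with stepR S
... | just (ρ , T) with run i T in eq
...   | just (ρs , _) with refl ← p | run-++ i {j} eq q
...     | τs , r rewrite r = ρ ∷ τs , refl

run⇒Pⁿ : ∀ i j {S ρs T} → i ≤ j → run j S ≡ just (ρs , T) → ∃ λ U → Pⁿ i S ≡ just U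
run⇒Pⁿ zero    j       {S} l p = S , refl
run⇒Pⁿ (suc i) (suc j) {S} (s≤s l) p with stepR S
... | just (ρ , T) with run j T in eq
...   | just _ = run⇒Pⁿ i j l eq

-- Identification with the states `S k`, and non-halting.

pow2-^ : ∀ n → pow2 n ≡ 2 ℕ.^ n
pow2-^ zero    = refl
pow2-^ (suc n) = cong₂ ℕ._+_ (pow2-^ n) (trans (pow2-^ n) (sym (ℕₚ.+-identityʳ _)))

-- Subtracting `halfPw` halves `pw` except at the top, where 1 - 1 produces the leading 0 of the
-- state.
powers : ∀ n → applyDownFrom (λ i → + (2 ℕ.^ suc i)) n ++ 0ℤ ∷ []
  ≡ applyUpTo (λ i → twice (+ pw (suc n) i ℤ.- + halfPw (suc n) i)) (suc n)
powers zero    = refl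
powers (suc n) = cong₂ _∷_ head-eq (powers n)
  where
  eq : ∀ p → p ℤ.+ p ≡ (p ℤ.+ p ℤ.- p) ℤ.+ (p ℤ.+ p ℤ.- p)
  eq = ℤR.solve-∀
  head-eq : + (2 ℕ.^ suc n) ≡ twice (+ pow2 (suc n) ℤ.- + pow2 n)
  head-eq = trans (cong +_ (sym (pow2-^ (suc n)))) (eq (+ pow2 n))

reverse-S : ∀ k → reverse (S (suc k)) ≡ Level.E (suc (dbl k)) (startCoords (3 ℕ.+ dbl k))
reverse-S k = begin
  reverse (0ℤ ∷ (map g (upTo n) ++ 0ℤ ∷ []))          ≡⟨ Lₚ.unfold-reverse 0ℤ (map g (upTo n) ++ 0ℤ ∷ []) ⟩
  reverse (map g (upTo n) ++ 0ℤ ∷ []) ++ 0ℤ ∷ []      ≡⟨ cong (_++ 0ℤ ∷ []) (Lₚ.reverse-++ (map g (upTo n)) (0ℤ ∷ [])) ⟩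
  0ℤ ∷ (reverse (map g (upTo n)) ++ 0ℤ ∷ [])          ≡⟨ cong (λ t → 0ℤ ∷ (reverse t ++ 0ℤ ∷ [])) (Lₚ.map-upTo g n) ⟩
  0ℤ ∷ (reverse (applyUpTo g n) ++ 0ℤ ∷ [])           ≡⟨ cong (λ t → 0ℤ ∷ (t ++ 0ℤ ∷ [])) (Lₚ.reverse-applyUpTo g n) ⟩
  0ℤ ∷ (applyDownFrom g n ++ 0ℤ ∷ [])                 ≡⟨ cong (0ℤ ∷_) (powers n) ⟩
  0ℤ ∷ applyUpTo (λ i → twice (+ pw (suc n) i ℤ.- + halfPw (suc n) i)) (suc n)
    ≡⟨ cong (λ l → 0ℤ ∷ applyUpTo (λ i → twice (+ pw (suc l) i ℤ.- + halfPw (suc l) i)) (suc l)) n≡ ⟩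
  Level.E (suc (dbl k)) (startCoords (3 ℕ.+ dbl k))            ∎
  where
  open ≡-Reasoning
  n = 2 ℕ.* suc k
  g : ℕ → ℤ
  g i = + (2 ℕ.^ suc i)
  eq : ∀ k → 2 ℕ.* suc k ≡ 2 ℕ.+ (k ℕ.+ k)
  eq = ℕR.solve-∀
  n≡ : n ≡ 2 ℕ.+ dbl k
  n≡ = trans (eq k) (cong (2 ℕ.+_) (sym (dbl-+ k)))

S-reverse : ∀ k → reverse (Level.E (suc (dbl k)) (startCoords (3 ℕ.+ dbl k))) ≡ S (suc k)
S-reverse k = trans (cong reverse (sym (reverse-S k))) (Lₚ.reverse-involutive (S (suc k)))

abstract
  start-pass : ∀ k →
    Level.E (suc (dbl k)) (startCoords (3 ℕ.+ dbl k)) ⟶[ 1 ] Level.E (3 ℕ.+ dbl k) (startCoords (5 ℕ.+ dbl k))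
  start-pass k = Pass.pass k

S-run : ∀ k → Σ ℕ λ j → Σ (List Rule) λ ρs →
  (run j (S (suc k)) ≡ just (ρs , S (suc (suc k)))) × (countOverflow ρs ≡ 1)
S-run k with ⟶⇒run (start-pass k)
... | j , ρs , runs , count = j , ρs ,
  trans (cong (run j) (sym (S-reverse k))) (trans runs (cong (λ t → just (ρs , t)) (S-reverse (suc k)))) , count

run-nonempty : ∀ j {S ρs T} → run j S ≡ just (ρs , T) → countOverflow ρs ≡ 1 → 1 ≤ j
run-nonempty zero    refl ()
run-nonempty (suc j) p    q = s≤s z≤n

-- Each pass contains an Overflow and hence at least one step, so n passes make a run of length at
-- least n.
run-long : ∀ n → Σ ℕ λ j → n ≤ j × (∃ λ ρs → run j (S 1) ≡ just (ρs , S (suc n)))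
run-long zero = 0 , z≤n , [] , refl
run-long (suc n) with run-long n | S-run n
... | j , n≤j , _ , runs | i , _ , runs′ , count =
  j ℕ.+ i , subst (_≤ j ℕ.+ i) (ℕₚ.+-comm n 1) (ℕₚ.+-mono-≤ n≤j (run-nonempty i runs′ count)) , run-++ j runs runs′

theorem1p3 : ((k : ℕ) → k ≥ 1 →
    Σ ℕ λ j → Σ (List Rule) λ ρs →
    (run j (S k) ≡ just (ρs , S (suc k))) × (countOverflow ρs ≡ 1))
    × ((j : ℕ) → ∃ λ T → Pⁿ j (S 1) ≡ just T)
theorem1p3 = (λ { (suc k) _ → S-run k }) , λ j → let (i , j≤i , _ , runs) = run-long j in run⇒Pⁿ j i j≤i runs
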